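{- Let $\mathcal{F}$ be an atomic system of subsets of $[n]=\{1,\ldots,n\}$ (that is, $\emptyset\in\mathcal{F}$ and $\{a\}\in\mathcal{F}$ for every $a\in[n]$), such that for any two disjoint members $A,B\in\mathcal{F}$, either there exists $a\in A$ such that $B\cup\{a\}\in\mathcal{F}$, or there exists $b\in B$ such that $A\cup\{b\}\in\mathcal{F}$. Then (i) $|\mathcal{F}|\ge e^{(2e^{ -1/\sqrt{2}}+o(1))\sqrt{n}}\ge 2^{(1.42+o(1))\sqrt{n}}$; (ii) $\mathrm{rk}(\mathcal{F})\ge \lfloor\sqrt{2n}\rceil$, and this bound is best possible. Consequently, $f(n)\ge 2^{(1.42+o(1))\sqrt{n}}$, where $f(n)$ denotes the minimum cardinality of a system $\mathcal{F}$ of subsets of $[n]$ that is atomic, downward closed (if $A\in\mathcal{F}$ then every subset of $A$ is in $\mathcal{F}$), and such that for any two disjoint members $A,B\in\mathcal{F}$ there exist $a\in A$ and $b\in B$ such that either $B\cup\{a\}\in\mathcal{F}$ and $(A\cup\{b\})\setminus\{a\}\in\mathcal{F}$, or $A\cup\{b\}\in\mathcal{F}$ and $(B\cup\{a\})\setminus\{b\}\in\mathcal{F}$.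
   Context: The rank $\mathrm{rk}(\mathcal{F})$ of a set-system $\mathcal{F}$ is the size of the largest set in $\mathcal{F}$. $\lfloor x\rceil$ denotes the integer closest to $x$. All logarithms are base 2. -}

module Defs where

open import Data.Nat as ℕ using (ℕ; zero; suc; _⊔_)
open import Data.Integer using (+_)
open import Data.Rational as ℚ using (ℚ; 0ℚ; 1ℚ)
open import Data.Fin using (Fin)
open import Data.Fin.Subset using (Subset; ⊥; ⁅_⁆; _∪_; _∩_; _─_; ∣_∣; Nonempty; _⊆_)
  renaming (_∈_ to _∈ˢ_)
open import Data.List using (List; foldr; length)
open import Data.List.Membership.Propositional using (_∈_)
open import Data.List.Relation.Unary.Unique.Propositional using (Unique)
open import Data.Product using (_×_; ∃; ∃₂)
open import Data.Sum using (_⊎_)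
open import Relation.Binary.PropositionalEquality using (_≡_)

record System (n : ℕ) : Set where
  constructor system
  field
    members : List (Subset n)
    unique  : Unique members
open System public

card : ∀ {n} → System n → ℕ
card F = length (members F)

-- rk(F): size of the largest member (0 for the empty system)
rk : ∀ {n} → System n → ℕ
rk F = foldr (λ A m → ∣ A ∣ ⊔ m) 0 (members F)

_∈F_ : ∀ {n} → Subset n → System n → Set
A ∈F F = A ∈ members F

Disjoint : ∀ {n} → Subset n → Subset n → Set
Disjoint A B = A ∩ B ≡ ⊥

Atomic : ∀ {n} → System n → Set
Atomic {n} F = (⊥ ∈F F) × ((a : Fin n) → ⁅ a ⁆ ∈F F)

DownClosed : ∀ {n} → System n → Set
DownClosed F = ∀ A B → A ∈F F → B ⊆ A → B ∈F F

WeakExchange : ∀ {n} → System n → Set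
WeakExchange {n} F =
  ∀ A B → A ∈F F → B ∈F F → Nonempty A → Nonempty B → Disjoint A B →
  (∃ λ (a : Fin n) → a ∈ˢ A × ((B ∪ ⁅ a ⁆) ∈F F)) ⊎
  (∃ λ (b : Fin n) → b ∈ˢ B × ((A ∪ ⁅ b ⁆) ∈F F))

StrongExchange : ∀ {n} → System n → Set
StrongExchange {n} F =
  ∀ A B → A ∈F F → B ∈F F → Nonempty A → Nonempty B → Disjoint A B →
  ∃₂ λ (a b : Fin n) → a ∈ˢ A × b ∈ˢ B ×
    ( ((B ∪ ⁅ a ⁆) ∈F F × (((A ∪ ⁅ b ⁆) ─ ⁅ a ⁆) ∈F F))
    ⊎ ((A ∪ ⁅ b ⁆) ∈F F × (((B ∪ ⁅ a ⁆) ─ ⁅ b ⁆) ∈F F)) )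

Good : ∀ {n} → System n → Set
Good F = Atomic F × WeakExchange F

StrongGood : ∀ {n} → System n → Set
StrongGood F = Atomic F × DownClosed F × StrongExchange F

-- Nearest integer to √(2n):  r = ⌊√(2n)⌉  iff  r - 1/2 < √(2n) < r + 1/2
-- (√(2n) is never a half-integer), i.e. (2r-1)² < 8n < (2r+1)² (the
-- lower condition dropped when r = 0).

IsRoundSqrt2n : ℕ → ℕ → Set
IsRoundSqrt2n n r =
  (r ≡ 0 ⊎ (2 ℕ.* r ℕ.∸ 1) ℕ.* (2 ℕ.* r ℕ.∸ 1) ℕ.< 8 ℕ.* n) ×
  (8 ℕ.* n ℕ.< (2 ℕ.* r ℕ.+ 1) ℕ.* (2 ℕ.* r ℕ.+ 1))

⟦_⟧ : ℕ → ℚ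
⟦ a ⟧ = + a ℚ./ 1

expTerm : ℚ → ℕ → ℚ
expTerm x zero    = 1ℚ
expTerm x (suc k) = expTerm x k ℚ.* x ℚ.* (+ 1 ℚ./ suc k)

expPartial : ℚ → ℕ → ℚ
expPartial x zero    = 0ℚ
expPartial x (suc N) = expPartial x N ℚ.+ expTerm x N

-- e^r ≤ a   (for rational r ≥ 0; e^r is the supremum of the partial sums)
ExpLe : ℚ → ℕ → Set
ExpLe r a = ∀ N → expPartial r N ℚ.≤ ⟦ a ⟧

-- a ≥ e^{α √n}  (α ≥ 0): a ≥ e^r for every rational 0 ≤ r ≤ α√n
GeExpSqrt : ℕ → ℚ → ℕ → Set
GeExpSqrt a α n = ∀ r → 0ℚ ℚ.≤ r → r ℚ.* r ℚ.≤ α ℚ.* α ℚ.* ⟦ n ⟧ → ExpLe r a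

-- a ≥ 2^{β √n}  (β ≥ 0): for every rational 0 ≤ p/t ≤ β√n, a^t ≥ 2^p
GePow2Sqrt : ℕ → ℚ → ℕ → Set
GePow2Sqrt a β n = ∀ p t →
  ⟦ p ⟧ ℚ.* ⟦ p ⟧ ℚ.≤ β ℚ.* β ℚ.* ⟦ n ⟧ ℚ.* ⟦ suc t ⟧ ℚ.* ⟦ suc t ⟧ →
  2 ℕ.^ p ℕ.≤ a ℕ.^ suc t

-- For rational α > 0:  α < 2 e^{-1/√2}  ⟺  e^{1/√2} < 2/α
--   ⟺ ∃ rational s > 1/√2 and δ > 0 with e^s + δ ≤ 2/α.
BelowConst : ℚ → Set
BelowConst α = ∃ λ s → 0ℚ ℚ.< s × 1ℚ ℚ.< ⟦ 2 ⟧ ℚ.* s ℚ.* s ×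
  ∃ λ δ → 0ℚ ℚ.< δ × (∀ N → α ℚ.* (expPartial s N ℚ.+ δ) ℚ.≤ ⟦ 2 ⟧)

c142 : ℚ
c142 = + 142 ℚ./ 100

{-# OPTIONS --safe #-}

-- If all members of F inside X have at most c points, then |X| ≤ c + (c − 1) + ... + 1: remove a
-- largest member from X; by exchange the members inside the rest are strictly smaller.  With X = [n]
-- this is the rank bound.
--
-- For the cardinality, colour [n] with q colours.  If n > q c(c+1)/2, some colour class has more than
-- c(c+1)/2 points, so it contains a member with at least c + 1 points.  Hence each of the q^n colourings has
-- a monochromatic member of size > c, and a single such member is monochromatic in at most
-- q · q^(n−c−1) colourings; so |F| ≥ q^c.  For q = 8 the hypothesis reads (2c+1)² ≤ n, whence
-- |F| ≥ 2^((3/2 + o(1))√n), which beats both 2^(1.42√n) and e^(2e^(-1/√2)√n).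
--
-- An optimal system is built block by block, the new block having at most one point more than the rank so far.
-- The new members are the subsets of the new block, and the old members together with at most one new point.

module Submission where

open import Defs
open import Data.Bool using (if_then_else_; true; false)
import Data.Bool.Properties as Boolₚ
open import Data.Empty using (⊥-elim)
open import Data.Fin as Fin using (Fin; _↑ˡ_; _↑ʳ_)
import Data.Fin.Properties as Finₚ
open import Data.Fin.Subset
  using (Subset; Nonempty; inside; outside; ⊥; ⊤; ⁅_⁆; _∪_; _∩_; _─_; ∣_∣; _⊆_)
  renaming (_∈_ to _∈ˢ_; _∉_ to _∉ˢ_)
open import Data.Fin.Subset.Properties
import Data.Integer as ℤ
import Data.Integer.Properties as ℤₚ
open import Data.List as List
  using (List; []; _∷_; foldr; length; lookup; filter; cartesianProductWith; cartesianProduct)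
open import Data.List.Properties using (length-filter)
open import Data.List.Membership.Propositional using (_∈_; find; lose)
open import Data.List.Membership.Propositional.Properties
  using (∈-lookup; ∈-filter⁺; ∈-filter⁻; ∈-map⁺; ∈-map⁻; ∈-cartesianProduct⁺; ∈-cartesianProductWith⁺)
import Data.List.Membership.DecPropositional as DecMembership
open import Data.List.Relation.Unary.All using ([]; _∷_)
open import Data.List.Relation.Unary.Any as Any using (here; there)
import Data.List.Relation.Unary.Any.Properties as Anyₚ
open import Data.List.Relation.Unary.Unique.Propositional using (Unique; []; _∷_)
import Data.List.Relation.Unary.Unique.Propositional.Properties as Uniqueₚ
open import Data.Nat as ℕ using (ℕ; zero; suc; _+_; _*_; _^_; _≤_; z≤n; s≤s)
import Data.Nat.Properties as ℕₚ
open import Data.Nat.Tactic.RingSolver using (solve-∀)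
open import Data.Product using (_×_; _,_; ∃; ∃₂; Σ; proj₂; uncurry)
open import Data.Rational as ℚ using (ℚ; 0ℚ; 1ℚ; _<_)
import Data.Rational.Properties as ℚₚ
open import Data.Rational.Solver using (module +-*-Solver)
import Data.Rational.Unnormalised as ℚᵘ
import Data.Rational.Unnormalised.Properties as ℚᵘₚ
open import Data.Sum using (_⊎_; inj₁; inj₂; swap)
open import Data.Unit using (tt)
open import Data.Vec as Vec using (Vec; []; _∷_; _++_)
import Data.Vec.Properties as Vecₚ
open import Function using (_∘_)
open import Relation.Nullary using (¬_; yes; no; Dec; does)
open import Relation.Nullary.Decidable using (_×-dec_; _⊎-dec_)
open import Relation.Binary.PropositionalEquality
open import Algebra.Properties.CommutativeMonoid.Sum ℕₚ.+-0-commutativeMonoid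
  using (∑-distrib-+; sum-cong-≗) renaming (sum to ∑)
open +-*-Solver using (solve; con; _:*_; _:+_; _:=_; :-_)

-- Members inside a set

tri : ℕ → ℕ
tri zero    = 0
tri (suc k) = suc k + tri k

tri-mono : ∀ {j k} → j ≤ k → tri j ≤ tri k
tri-mono z≤n       = z≤n
tri-mono (s≤s j≤k) = ℕₚ.+-mono-≤ (s≤s j≤k) (tri-mono j≤k)

∣p∣≤∣q∣+∣p─q∣ : ∀ {n} (p q : Subset n) → ∣ p ∣ ≤ ∣ q ∣ + ∣ p ─ q ∣
∣p∣≤∣q∣+∣p─q∣ []            []            = z≤n
∣p∣≤∣q∣+∣p─q∣ (inside  ∷ p) (inside  ∷ q) = s≤s (∣p∣≤∣q∣+∣p─q∣ p q)
∣p∣≤∣q∣+∣p─q∣ (outside ∷ p) (inside  ∷ q) = ℕₚ.m≤n⇒m≤1+n (∣p∣≤∣q∣+∣p─q∣ p q)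
∣p∣≤∣q∣+∣p─q∣ (outside ∷ p) (outside ∷ q) = ∣p∣≤∣q∣+∣p─q∣ p q
∣p∣≤∣q∣+∣p─q∣ (inside  ∷ p) (outside ∷ q) =
  subst (suc ∣ p ∣ ≤_) (sym (ℕₚ.+-suc ∣ q ∣ _)) (s≤s (∣p∣≤∣q∣+∣p─q∣ p q))

-- If `p ─ q` met `q`, removing `q` a second time would make it strictly smaller, yet the second
-- removal changes nothing.
x∈p─q⇒x∉q : ∀ {n x} (p q : Subset n) → x ∈ˢ p ─ q → x ∉ˢ q
x∈p─q⇒x∉q p q x∈p─q x∈q =
  ℕₚ.<-irrefl (cong ∣_∣ (p─q─q≡p─q p q))
    (p∩q≢∅⇒∣p─q∣<∣p∣ (p ─ q) q (_ , x∈p∩q⁺ (x∈p─q , x∈q)))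

disjoint : ∀ {n} {p q : Subset n} → (∀ {x} → x ∈ˢ p → x ∉ˢ q) → Disjoint p q
disjoint {p = p} {q} d = Empty-unique λ (_ , x∈p∩q) →
  let x∈p , x∈q = x∈p∩q⁻ p q x∈p∩q in d x∈p x∈q

∣p∣<∣p∪⁅x⁆∣ : ∀ {n} {x : Fin n} {p} → x ∉ˢ p → ∣ p ∣ ℕ.< ∣ p ∪ ⁅ x ⁆ ∣
∣p∣<∣p∪⁅x⁆∣ {x = x} {p} x∉p =
  p⊂q⇒∣p∣<∣q∣ (p⊆p∪q ⁅ x ⁆ , x , q⊆p∪q p ⁅ x ⁆ (x∈⁅x⁆ x) , x∉p)

p∪⁅x⁆⊆q : ∀ {n} {x : Fin n} {p q} → p ⊆ q → x ∈ˢ q → p ∪ ⁅ x ⁆ ⊆ q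
p∪⁅x⁆⊆q {x = x} {p} p⊆q x∈q y∈ with x∈p∪q⁻ p ⁅ x ⁆ y∈
... | inj₁ y∈p = p⊆q y∈p
... | inj₂ y∈x rewrite x∈⁅y⁆⇒x≡y x y∈x = x∈q

Empty⇒∣p∣≡0 : ∀ {n} {p : Subset n} → ¬ Nonempty p → ∣ p ∣ ≡ 0
Empty⇒∣p∣≡0 {n} empty = trans (cong ∣_∣ (Empty-unique empty)) (∣⊥∣≡0 n)

∣p∣>0⇒Nonempty : ∀ {n} (p : Subset n) → 1 ≤ ∣ p ∣ → Nonempty p
∣p∣>0⇒Nonempty p 1≤∣p∣ with nonempty? p
... | yes ne = ne
... | no empty = ⊥-elim (ℕₚ.n≮0 (subst (1 ≤_) (Empty⇒∣p∣≡0 empty) 1≤∣p∣))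

-- The set `X` is arbitrary because the recursion passes to `X ─ A` and the colouring argument needs
-- colour classes. The recursion is on `c`, which drops at each call whether or not `X` shrinks.
∣X∣≤tri : ∀ {n} (F : System n) → Good F → ∀ c X →
          (∀ {A} → A ∈F F → A ⊆ X → ∣ A ∣ ≤ c) → ∣ X ∣ ≤ tri c
∣X∣≤tri F ((_ , singletons) , _) zero X small with nonempty? X
... | no empty = ℕₚ.≤-reflexive (Empty⇒∣p∣≡0 empty)
... | yes (x , x∈X) =
  ⊥-elim (ℕₚ.n≮0 (subst (_≤ 0) (∣⁅x⁆∣≡1 x) (small (singletons x) ⁅x⁆⊆X)))
  where
  ⁅x⁆⊆X : ⁅ x ⁆ ⊆ X
  ⁅x⁆⊆X y∈ rewrite x∈⁅y⁆⇒x≡y x y∈ = x∈X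
∣X∣≤tri F good@(_ , exchange) (suc c) X small
  with Any.any? (λ A → (A ⊆? X) ×-dec (∣ A ∣ ℕ.≟ suc c)) (members F)
... | no none = ℕₚ.≤-trans (∣X∣≤tri F good c X smaller) (ℕₚ.m≤n+m (tri c) (suc c))
  where
  smaller : ∀ {A} → A ∈F F → A ⊆ X → ∣ A ∣ ≤ c
  smaller A∈F A⊆X = ℕₚ.≤-pred (ℕₚ.≤∧≢⇒< (small A∈F A⊆X) λ eq → none (lose A∈F (A⊆X , eq)))
... | yes some with A , A∈F , A⊆X , ∣A∣≡ ← find some = begin
  ∣ X ∣                 ≤⟨ ∣p∣≤∣q∣+∣p─q∣ X A ⟩
  ∣ A ∣ + ∣ X ─ A ∣     ≤⟨ ℕₚ.+-mono-≤ (ℕₚ.≤-reflexive ∣A∣≡) (∣X∣≤tri F good c (X ─ A) smaller) ⟩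
  suc c + tri c         ∎
  where
  open ℕₚ.≤-Reasoning
  smaller : ∀ {B} → B ∈F F → B ⊆ X ─ A → ∣ B ∣ ≤ c
  smaller {B} B∈F B⊆X─A with nonempty? B
  ... | no empty = subst (_≤ c) (sym (Empty⇒∣p∣≡0 empty)) z≤n
  ... | yes B≠∅ with exchange A B A∈F B∈F
                       (∣p∣>0⇒Nonempty A (subst (1 ≤_) (sym ∣A∣≡) (s≤s z≤n))) B≠∅
                       (disjoint λ x∈A x∈B → x∈p─q⇒x∉q X A (B⊆X─A x∈B) x∈A)
  -- `B ∪ ⁅ a ⁆` still lies in `X`, so it has at most `suc c` points, and `B` has one point fewer.
  ... | inj₁ (a , a∈A , B+a∈F) = ℕₚ.≤-pred (ℕₚ.≤-trans
          (∣p∣<∣p∪⁅x⁆∣ λ a∈B → x∈p─q⇒x∉q X A (B⊆X─A a∈B) a∈A)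
          (small B+a∈F (p∪⁅x⁆⊆q (p─q⊆p X A ∘ B⊆X─A) (A⊆X a∈A))))
  -- `A` already has the maximal size `suc c` and cannot grow inside `X`.
  ... | inj₂ (b , b∈B , A+b∈F) = ⊥-elim (ℕₚ.<-irrefl ∣A∣≡ (ℕₚ.≤-trans
          (∣p∣<∣p∪⁅x⁆∣ (x∈p─q⇒x∉q X A (B⊆X─A b∈B)))
          (small A+b∈F (p∪⁅x⁆⊆q A⊆X (p─q⊆p X A (B⊆X─A b∈B))))))

largeMember : ∀ {n} (F : System n) → Good F → ∀ c X → tri c ℕ.< ∣ X ∣ →
              ∃ λ A → A ∈F F × A ⊆ X × c ℕ.< ∣ A ∣
largeMember F good c X tri<∣X∣ with Any.any? (λ A → (A ⊆? X) ×-dec (suc c ℕ.≤? ∣ A ∣)) (members F)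
... | yes some with A , A∈F , A⊆X , c<∣A∣ ← find some = A , A∈F , A⊆X , c<∣A∣
... | no none  = ⊥-elim (ℕₚ.<⇒≱ tri<∣X∣ (∣X∣≤tri F good c X
                   λ A∈F A⊆X → ℕₚ.≮⇒≥ λ c<∣A∣ → none (lose A∈F (A⊆X , c<∣A∣))))

∣A∣≤rk : ∀ {n} (F : System n) {A} → A ∈F F → ∣ A ∣ ≤ rk F
∣A∣≤rk (system As _) = go As
  where
  go : ∀ {n} {A} (As : List (Subset n)) → A ∈ As → ∣ A ∣ ≤ foldr (λ A m → ∣ A ∣ ℕ.⊔ m) 0 As
  go (B ∷ Bs) (here refl) = ℕₚ.m≤m⊔n _ _
  go (B ∷ Bs) (there A∈) = ℕₚ.≤-trans (go Bs A∈) (ℕₚ.m≤n⊔m ∣ B ∣ _)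

rk≤ : ∀ {n r} (F : System n) → (∀ {A} → A ∈F F → ∣ A ∣ ≤ r) → rk F ≤ r
rk≤ (system As _) = go As
  where
  go : ∀ {n r} (As : List (Subset n)) → (∀ {A} → A ∈ As → ∣ A ∣ ≤ r) → foldr (λ A m → ∣ A ∣ ℕ.⊔ m) 0 As ≤ r
  go []       small = z≤n
  go (A ∷ As) small = ℕₚ.⊔-lub (small (here refl)) (go As (small ∘ there))

-- Sums over colourings

∑-mono : ∀ {q} {f g : Fin q → ℕ} → (∀ i → f i ≤ g i) → ∑ f ≤ ∑ g
∑-mono {zero}  f≤g = z≤n
∑-mono {suc q} f≤g = ℕₚ.+-mono-≤ (f≤g Fin.zero) (∑-mono (f≤g ∘ Fin.suc))

∑-const : ∀ q c → ∑ {q} (λ _ → c) ≡ q * c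
∑-const zero    c = refl
∑-const (suc q) c = cong (c +_) (∑-const q c)

f≤∑f : ∀ {q} (f : Fin q → ℕ) i → f i ≤ ∑ f
f≤∑f f Fin.zero    = ℕₚ.m≤m+n _ _
f≤∑f f (Fin.suc i) = ℕₚ.≤-trans (f≤∑f (f ∘ Fin.suc) i) (ℕₚ.m≤n+m _ _)

∑-*ˡ : ∀ {q} c (f : Fin q → ℕ) → c * ∑ f ≡ ∑ (λ i → c * f i)
∑-*ˡ {zero}  c f = ℕₚ.*-zeroʳ c
∑-*ˡ {suc q} c f = trans (ℕₚ.*-distribˡ-+ c (f Fin.zero) _) (cong (c * f Fin.zero +_) (∑-*ˡ c (f ∘ Fin.suc)))

∑-δ : ∀ {q} (j : Fin q) c → ∑ (λ i → if does (i Fin.≟ j) then c else 0) ≡ c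
∑-δ {suc q} Fin.zero    c = trans (cong (c +_) (trans (∑-const q 0) (ℕₚ.*-zeroʳ q))) (ℕₚ.+-identityʳ c)
∑-δ {suc q} (Fin.suc j) c = ∑-δ j c

-- The sum runs over the other argument of `≟`. Both forms are needed: here a point is fixed and the
-- colour varies, as in `∑∣colourClass∣`; in `∑-δ` the colour is fixed, as in `∑ᶜ-coloured`.
∑-δ′ : ∀ {q} (i : Fin q) c → ∑ (λ j → if does (i Fin.≟ j) then c else 0) ≡ c
∑-δ′ {suc q} Fin.zero    c = trans (cong (c +_) (trans (∑-const q 0) (ℕₚ.*-zeroʳ q))) (ℕₚ.+-identityʳ c)
∑-δ′ {suc q} (Fin.suc i) c = ∑-δ′ i c

Colouring : ℕ → ℕ → Set
Colouring q n = Vec (Fin q) n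

colourClass : ∀ {q n} → Fin q → Colouring q n → Subset n
colourClass j = Vec.map (λ i → does (i Fin.≟ j))

∑∣colourClass∣ : ∀ {q n} (v : Colouring q n) → ∑ (λ j → ∣ colourClass j v ∣) ≡ n
∑∣colourClass∣ {q} []      = trans (∑-const q 0) (ℕₚ.*-zeroʳ q)
∑∣colourClass∣ {q} {suc n} (i ∷ v) = begin
  ∑ (λ j → ∣ colourClass j (i ∷ v) ∣)
    ≡⟨ sum-cong-≗ split ⟩
  ∑ (λ j → (if does (i Fin.≟ j) then 1 else 0) + ∣ colourClass j v ∣)
    ≡⟨ ∑-distrib-+ {q} (λ j → if does (i Fin.≟ j) then 1 else 0) (λ j → ∣ colourClass j v ∣) ⟩
  ∑ (λ j → if does (i Fin.≟ j) then 1 else 0) + ∑ (λ j → ∣ colourClass j v ∣)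
    ≡⟨ cong₂ _+_ (∑-δ′ i 1) (∑∣colourClass∣ v) ⟩
  suc n ∎
  where
  open ≡-Reasoning
  split : ∀ j → ∣ colourClass j (i ∷ v) ∣ ≡ (if does (i Fin.≟ j) then 1 else 0) + ∣ colourClass j v ∣
  split j with does (i Fin.≟ j)
  ... | true  = refl
  ... | false = refl

pigeonhole : ∀ {q n t} → q * t ℕ.< n → (v : Colouring q n) → ∃ λ j → t ℕ.< ∣ colourClass j v ∣
pigeonhole {q} {n} {t} qt<n v with Finₚ.any? (λ j → suc t ℕ.≤? ∣ colourClass j v ∣)
... | yes large = large
... | no none = ⊥-elim (ℕₚ.<⇒≱ qt<n (begin
  n                                  ≡⟨ ∑∣colourClass∣ v ⟨
  ∑ (λ j → ∣ colourClass j v ∣)      ≤⟨ ∑-mono (λ j → ℕₚ.≮⇒≥ (none ∘ (j ,_))) ⟩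
  ∑ {q} (λ _ → t)                    ≡⟨ ∑-const q t ⟩
  q * t                              ∎))
  where open ℕₚ.≤-Reasoning

-- Summing one point at a time allows induction on the ground set without listing the colourings.
∑ᶜ : ∀ {q} n → (Colouring q n → ℕ) → ℕ
∑ᶜ zero    f = f []
∑ᶜ (suc n) f = ∑ (λ i → ∑ᶜ n (λ v → f (i ∷ v)))

∑ᶜ-mono : ∀ {q} n {f g : Colouring q n → ℕ} → (∀ v → f v ≤ g v) → ∑ᶜ n f ≤ ∑ᶜ n g
∑ᶜ-mono zero    f≤g = f≤g []
∑ᶜ-mono (suc n) f≤g = ∑-mono λ i → ∑ᶜ-mono n (f≤g ∘ (i ∷_))

∑ᶜ-const : ∀ q n c → ∑ᶜ {q} n (λ _ → c) ≡ q ^ n * c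
∑ᶜ-const q zero    c = sym (ℕₚ.*-identityˡ c)
∑ᶜ-const q (suc n) c = begin
  ∑ {q} (λ _ → ∑ᶜ {q} n (λ _ → c))  ≡⟨ ∑-const q _ ⟩
  q * ∑ᶜ {q} n (λ _ → c)            ≡⟨ cong (q *_) (∑ᶜ-const q n c) ⟩
  q * (q ^ n * c)                   ≡⟨ ℕₚ.*-assoc q (q ^ n) c ⟨
  q * q ^ n * c                     ∎
  where open ≡-Reasoning

∑ᶜ-+ : ∀ {q} n (f g : Colouring q n → ℕ) → ∑ᶜ n (λ v → f v + g v) ≡ ∑ᶜ n f + ∑ᶜ n g
∑ᶜ-+ zero    f g = refl
∑ᶜ-+ (suc n) f g = trans (sum-cong-≗ (λ i → ∑ᶜ-+ n (f ∘ (i ∷_)) (g ∘ (i ∷_)))) (∑-distrib-+ (λ i → ∑ᶜ n (f ∘ (i ∷_))) (λ i → ∑ᶜ n (g ∘ (i ∷_))))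

∑ᶜ-∑ : ∀ {q} n {m} (f : Fin m → Colouring q n → ℕ) → ∑ᶜ n (λ v → ∑ (λ j → f j v)) ≡ ∑ (λ j → ∑ᶜ n (f j))
∑ᶜ-∑ {q} n {zero}  f = trans (∑ᶜ-const q n 0) (ℕₚ.*-zeroʳ (q ^ n))
∑ᶜ-∑ n {suc m} f = trans (∑ᶜ-+ n (f Fin.zero) _) (cong (∑ᶜ n (f Fin.zero) +_) (∑ᶜ-∑ n (f ∘ Fin.suc)))

-- The 0/1 indicator of `A ⊆ colourClass j v`, with values in ℕ so that its sum over colourings
-- factors point by point.
coloured : ∀ {q n} → Subset n → Fin q → Colouring q n → ℕ
coloured []            j []      = 1
coloured (outside ∷ A) j (i ∷ v) = coloured A j v
coloured (inside  ∷ A) j (i ∷ v) = if does (i Fin.≟ j) then coloured A j v else 0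

⊆colourClass⇒coloured : ∀ {q n} (A : Subset n) (j : Fin q) v → A ⊆ colourClass j v → 1 ≤ coloured A j v
⊆colourClass⇒coloured []            j []      A⊆ = s≤s z≤n
⊆colourClass⇒coloured (outside ∷ A) j (i ∷ v) A⊆ = ⊆colourClass⇒coloured A j v (drop-∷-⊆ A⊆)
⊆colourClass⇒coloured (inside  ∷ A) j (i ∷ v) A⊆ with does (i Fin.≟ j)
... | true  = ⊆colourClass⇒coloured A j v (drop-∷-⊆ A⊆)
... | false with () ← A⊆ Vec.here

∑ᶜ-if : ∀ {q} n b (f : Colouring q n → ℕ) → ∑ᶜ n (λ v → if b then f v else 0) ≡ (if b then ∑ᶜ n f else 0)
∑ᶜ-if     n true  f = refl
∑ᶜ-if {q} n false f = trans (∑ᶜ-const q n 0) (ℕₚ.*-zeroʳ (q ^ n))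

-- A point outside `A` may take any of the `q` colours, a point of `A` only the colour `j`. So the
-- count is q^(n - |A|); multiplying by `q ^ ∣ A ∣` avoids the subtraction.
∑ᶜ-coloured : ∀ {q n} (A : Subset n) (j : Fin q) → q ^ ∣ A ∣ * ∑ᶜ n (coloured A j) ≡ q ^ n
∑ᶜ-coloured []            j = refl
∑ᶜ-coloured {q} {suc n} (outside ∷ A) j = begin
  q ^ ∣ A ∣ * ∑ {q} (λ _ → ∑ᶜ n (coloured A j))  ≡⟨ cong (q ^ ∣ A ∣ *_) (∑-const q _) ⟩
  q ^ ∣ A ∣ * (q * ∑ᶜ n (coloured A j))          ≡⟨ lemma (q ^ ∣ A ∣) q _ ⟩
  q * (q ^ ∣ A ∣ * ∑ᶜ n (coloured A j))          ≡⟨ cong (q *_) (∑ᶜ-coloured A j) ⟩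
  q * q ^ n                                      ∎
  where
  open ≡-Reasoning
  lemma : ∀ a b c → a * (b * c) ≡ b * (a * c)
  lemma = solve-∀
∑ᶜ-coloured {q} {suc n} (inside ∷ A) j = begin
  q * q ^ ∣ A ∣ * ∑ (λ i → ∑ᶜ n (λ v → if does (i Fin.≟ j) then coloured A j v else 0))
    ≡⟨ cong (q * q ^ ∣ A ∣ *_) (sum-cong-≗ λ i → ∑ᶜ-if n (does (i Fin.≟ j)) (coloured A j)) ⟩
  q * q ^ ∣ A ∣ * ∑ (λ i → if does (i Fin.≟ j) then ∑ᶜ n (coloured A j) else 0)
    ≡⟨ cong (q * q ^ ∣ A ∣ *_) (∑-δ j _) ⟩
  q * q ^ ∣ A ∣ * ∑ᶜ n (coloured A j)
    ≡⟨ ℕₚ.*-assoc q (q ^ ∣ A ∣) _ ⟩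
  q * (q ^ ∣ A ∣ * ∑ᶜ n (coloured A j))
    ≡⟨ cong (q *_) (∑ᶜ-coloured A j) ⟩
  q * q ^ n ∎
  where open ≡-Reasoning

-- The union bound over monochromatic members

unionBound : ∀ {q n k} .{{_ : ℕ.NonZero q}} (L : List (Subset n)) →
             (∀ {A} → A ∈ L → k ≤ ∣ A ∣) →
             (∀ (v : Colouring q n) → ∃₂ λ A j → A ∈ L × A ⊆ colourClass j v) →
             q ^ k ≤ length L * q
unionBound {q} {n} {k} L large covers = ℕₚ.*-cancelʳ-≤ (q ^ k) (length L * q) (q ^ n) {{ℕₚ.m^n≢0 q n}} (begin
  q ^ k * q ^ n
    ≡⟨ cong (q ^ k *_) (trans (∑ᶜ-const q n 1) (ℕₚ.*-identityʳ _)) ⟨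
  q ^ k * ∑ᶜ {q} n (λ _ → 1)
    ≤⟨ ℕₚ.*-monoʳ-≤ (q ^ k) (∑ᶜ-mono n covered) ⟩
  q ^ k * ∑ᶜ n (λ v → ∑ λ x → ∑ λ j → coloured (lookup L x) j v)
    ≡⟨ cong (q ^ k *_) (∑ᶜ-∑ n (λ x v → ∑ λ j → coloured (lookup L x) j v)) ⟩
  q ^ k * ∑ (λ x → ∑ᶜ n (λ v → ∑ λ j → coloured (lookup L x) j v))
    ≡⟨ ∑-*ˡ (q ^ k) (λ x → ∑ᶜ n (λ v → ∑ λ j → coloured (lookup L x) j v)) ⟩
  ∑ (λ x → q ^ k * ∑ᶜ n (λ v → ∑ λ j → coloured (lookup L x) j v))
    ≤⟨ ∑-mono each ⟩
  ∑ {length L} (λ _ → q * q ^ n)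
    ≡⟨ ∑-const (length L) (q * q ^ n) ⟩
  length L * (q * q ^ n)
    ≡⟨ ℕₚ.*-assoc (length L) q (q ^ n) ⟨
  length L * q * q ^ n ∎)
  where
  open ℕₚ.≤-Reasoning
  -- Every colouring contributes at least 1 to the double sum over positions in `L` and colours,
  -- namely through the member that covers it.
  covered : ∀ v → 1 ≤ ∑ λ x → ∑ λ j → coloured (lookup L x) j v
  covered v with A , j , A∈L , A⊆ ← covers v = ℕₚ.≤-trans
    (⊆colourClass⇒coloured (lookup L x) j v (subst (_⊆ colourClass j v) (Anyₚ.lookup-index A∈L) A⊆))
    (ℕₚ.≤-trans (f≤∑f (λ j → coloured (lookup L x) j v) j)
                (f≤∑f (λ x → ∑ λ j → coloured (lookup L x) j v) x))
    where x = Any.index A∈L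
  each : ∀ x → q ^ k * ∑ᶜ n (λ v → ∑ {q} λ j → coloured (lookup L x) j v) ≤ q * q ^ n
  each x = begin
    q ^ k * ∑ᶜ n (λ v → ∑ {q} λ j → coloured A j v)   ≡⟨ cong (q ^ k *_) (∑ᶜ-∑ n (coloured A)) ⟩
    q ^ k * ∑ {q} (λ j → ∑ᶜ n (coloured A j))         ≡⟨ ∑-*ˡ {q} (q ^ k) (λ j → ∑ᶜ n (coloured A j)) ⟩
    ∑ {q} (λ j → q ^ k * ∑ᶜ n (coloured A j))
      -- Raising `q ^ k` to `q ^ ∣ A ∣` makes `∑ᶜ-coloured` applicable for each colour.
      ≤⟨ ∑-mono {q} (λ j → ℕₚ.*-monoˡ-≤ (∑ᶜ n (coloured A j)) (ℕₚ.^-monoʳ-≤ q (large (∈-lookup {xs = L} x)))) ⟩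
    ∑ {q} (λ j → q ^ ∣ A ∣ * ∑ᶜ n (coloured A j))     ≡⟨ sum-cong-≗ {q} (∑ᶜ-coloured A) ⟩
    ∑ {q} (λ _ → q ^ n)                               ≡⟨ ∑-const q (q ^ n) ⟩
    q * q ^ n                                         ∎
    where A = lookup L x

q^c≤card : ∀ {n} (F : System n) → Good F → ∀ q c .{{_ : ℕ.NonZero q}} → q * tri c ℕ.< n → q ^ c ≤ card F
q^c≤card {n} F good q c q*tri<n = begin
  -- The union bound for size c + 1 gives q^(c+1) ≤ |L| q; one factor `q` is spent on the choice of
  -- the colour.
  q ^ c      ≤⟨ ℕₚ.*-cancelˡ-≤ q (ℕₚ.≤-trans (unionBound L (proj₂ ∘ ∈-filter⁻ large? {xs = members F}) covers)
                                             (ℕₚ.≤-reflexive (ℕₚ.*-comm (length L) q))) ⟩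
  length L   ≤⟨ length-filter large? (members F) ⟩
  card F     ∎
  where
  open ℕₚ.≤-Reasoning
  large? : (A : Subset n) → Dec (suc c ≤ ∣ A ∣)
  large? A = suc c ℕ.≤? ∣ A ∣
  L = filter large? (members F)
  covers : ∀ (v : Colouring q n) → ∃₂ λ A j → A ∈ L × A ⊆ colourClass j v
  covers v with j , tri<∣class∣ ← pigeonhole q*tri<n v
           with A , A∈F , A⊆ , c<∣A∣ ← largeMember F good c (colourClass j v) tri<∣class∣
    = A , j , ∈-filter⁺ large? A∈F c<∣A∣ , A⊆

-- A system of rank r on r(r+1)/2 points

subsets : ∀ n → List (Subset n)
subsets zero    = [] ∷ []
subsets (suc n) = cartesianProductWith _∷_ (outside ∷ inside ∷ []) (subsets n)

∈-subsets : ∀ {n} (A : Subset n) → A ∈ subsets n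
∈-subsets []      = here refl
∈-subsets (s ∷ A) = ∈-cartesianProductWith⁺ _∷_ (side s) (∈-subsets A)
  where
  side : ∀ s → s ∈ (outside ∷ inside ∷ [])
  side outside = here refl
  side inside  = there (here refl)

subsets-unique : ∀ n → Unique (subsets n)
subsets-unique zero    = [] ∷ []
subsets-unique (suc n) = Uniqueₚ.cartesianProductWith⁺ _∷_ Vecₚ.∷-injective
  (((λ ()) ∷ []) ∷ [] ∷ []) (subsets-unique n)

-- Subsets of a ground set split into two blocks

∣++∣ : ∀ {m n} (P : Subset m) (Q : Subset n) → ∣ P ++ Q ∣ ≡ ∣ P ∣ + ∣ Q ∣
∣++∣ []            Q = refl
∣++∣ (inside  ∷ P) Q = cong suc (∣++∣ P Q)
∣++∣ (outside ∷ P) Q = ∣++∣ P Q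

⊥-++ : ∀ m {n} → ⊥ {m + n} ≡ ⊥ {m} ++ ⊥
⊥-++ zero    = refl
⊥-++ (suc m) = cong (outside ∷_) (⊥-++ m)

⁅↑ˡ⁆ : ∀ {m} n (i : Fin m) → ⁅ i ↑ˡ n ⁆ ≡ ⁅ i ⁆ ++ ⊥
⁅↑ˡ⁆ {suc m} n Fin.zero    = cong (inside ∷_) (⊥-++ m)
⁅↑ˡ⁆ {suc m} n (Fin.suc i) = cong (outside ∷_) (⁅↑ˡ⁆ n i)

⁅↑ʳ⁆ : ∀ m {n} (i : Fin n) → ⁅ m ↑ʳ i ⁆ ≡ ⊥ {m} ++ ⁅ i ⁆
⁅↑ʳ⁆ zero    i = refl
⁅↑ʳ⁆ (suc m) i = cong (outside ∷_) (⁅↑ʳ⁆ m i)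

∪-++ : ∀ {m n} (P P′ : Subset m) (Q Q′ : Subset n) → (P ++ Q) ∪ (P′ ++ Q′) ≡ (P ∪ P′) ++ (Q ∪ Q′)
∪-++ P P′ Q Q′ = Vecₚ.zipWith-++ _ P Q P′ Q′

∪⁅↑ˡ⁆ : ∀ {m n} (P : Subset m) (Q : Subset n) i → (P ++ Q) ∪ ⁅ i ↑ˡ n ⁆ ≡ (P ∪ ⁅ i ⁆) ++ Q
∪⁅↑ˡ⁆ {n = n} P Q i = trans (cong ((P ++ Q) ∪_) (⁅↑ˡ⁆ n i))
  (trans (∪-++ P ⁅ i ⁆ Q ⊥) (cong ((P ∪ ⁅ i ⁆) ++_) (∪-identityʳ Q)))

∪⁅↑ʳ⁆ : ∀ {m n} (P : Subset m) (Q : Subset n) i → (P ++ Q) ∪ ⁅ m ↑ʳ i ⁆ ≡ P ++ (Q ∪ ⁅ i ⁆)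
∪⁅↑ʳ⁆ {m} P Q i = trans (cong ((P ++ Q) ∪_) (⁅↑ʳ⁆ m i))
  (trans (∪-++ P ⊥ Q ⁅ i ⁆) (cong (_++ (Q ∪ ⁅ i ⁆)) (∪-identityʳ P)))

∈-++ˡ : ∀ {m n} {P : Subset m} {Q : Subset n} {i} → i ∈ˢ P → (i ↑ˡ n) ∈ˢ (P ++ Q)
∈-++ˡ {P = P} {Q} {i} i∈P = Vecₚ.lookup⇒[]= _ (P ++ Q) (trans (Vecₚ.lookup-++ˡ P Q i) (Vecₚ.[]=⇒lookup i∈P))

∈-++ʳ : ∀ {m n} {P : Subset m} {Q : Subset n} {i} → i ∈ˢ Q → (m ↑ʳ i) ∈ˢ (P ++ Q)
∈-++ʳ {P = P} {Q} {i} i∈Q = Vecₚ.lookup⇒[]= _ (P ++ Q) (trans (Vecₚ.lookup-++ʳ P Q i) (Vecₚ.[]=⇒lookup i∈Q))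

Disjoint-++⁻ : ∀ {m n} (P P′ : Subset m) {Q Q′ : Subset n} →
               Disjoint (P ++ Q) (P′ ++ Q′) → Disjoint P P′ × Disjoint Q Q′
Disjoint-++⁻ {m} P P′ {Q} {Q′} eq = Vecₚ.++-injective (P ∩ P′) ⊥
  (trans (sym (Vecₚ.zipWith-++ _ P Q P′ Q′)) (trans eq (⊥-++ m)))

¬Nonempty⇒Nonempty-++ : ∀ {m n} (P : Subset m) {Q : Subset n} → Nonempty (P ++ Q) → ¬ Nonempty Q → Nonempty P
¬Nonempty⇒Nonempty-++ {m} P {Q} (x , x∈) Q≡∅ with nonempty? P
... | yes P≠∅ = P≠∅
... | no P≡∅  = ⊥-elim (∉⊥ (subst (x ∈ˢ_) (trans (cong₂ _++_ (Empty-unique P≡∅) (Empty-unique Q≡∅)) (sym (⊥-++ m))) x∈))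

module Extension {m n : ℕ} (F : System n) where

  -- The new block occupies the first `m` coordinates and carries `P`; the old ground set carries
  -- `Q`.
  Member : Subset m × Subset n → Set
  Member (P , Q) = Q ≡ ⊥ ⊎ (∣ P ∣ ≤ 1 × Q ∈F F)

  member? : ∀ PQ → Dec (Member PQ)
  member? (P , Q) = (Vecₚ.≡-dec Boolₚ._≟_ Q ⊥) ⊎-dec ((∣ P ∣ ℕ.≤? 1) ×-dec DecMembership._∈?_ (Vecₚ.≡-dec Boolₚ._≟_) Q (members F))

  pairs : List (Subset m × Subset n)
  pairs = filter member? (cartesianProduct (subsets m) (subsets n))

  -- Filtering the product of two duplicate-free lists and mapping by the injective `_++_` keeps the
  -- members distinct. Appending the two families would list `P ++ ⊥` with `∣ P ∣ ≤ 1` twice when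
  -- `⊥ ∈F F`.
  extension : System (m + n)
  extension = system (List.map (uncurry _++_) pairs)
    (Uniqueₚ.map⁺ (λ {(P , Q)} {(P′ , Q′)} eq → cong₂ _,_ (Vecₚ.++-injectiveˡ P P′ eq) (Vecₚ.++-injectiveʳ P P′ eq))
      (Uniqueₚ.filter⁺ member? (Uniqueₚ.cartesianProduct⁺ (subsets-unique m) (subsets-unique n))))

  member⁺ : ∀ P Q → Member (P , Q) → (P ++ Q) ∈F extension
  member⁺ P Q PQ∈ = ∈-map⁺ (uncurry _++_) (∈-filter⁺ member? (∈-cartesianProduct⁺ (∈-subsets P) (∈-subsets Q)) PQ∈)

  member⁻ : ∀ {A} → A ∈F extension → ∃₂ λ P Q → A ≡ P ++ Q × Member (P , Q)
  member⁻ A∈ with (P , Q) , PQ∈ , eq ← ∈-map⁻ (uncurry _++_) A∈ =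
    P , Q , eq , proj₂ (∈-filter⁻ member? {xs = cartesianProduct (subsets m) (subsets n)} PQ∈)

  extension-atomic : Atomic F → Atomic extension
  extension-atomic (⊥∈F , singletons) = subst (_∈F extension) (sym (⊥-++ m)) (member⁺ ⊥ ⊥ (inj₁ refl)) , single
    where
    single : ∀ a → ⁅ a ⁆ ∈F extension
    single a with Fin.splitAt m a | Finₚ.join-splitAt m n a
    ... | inj₁ i | refl = subst (_∈F extension) (sym (⁅↑ˡ⁆ n i)) (member⁺ ⁅ i ⁆ ⊥ (inj₁ refl))
    ... | inj₂ j | refl = subst (_∈F extension) (sym (⁅↑ʳ⁆ m j))
      (member⁺ ⊥ ⁅ j ⁆ (inj₂ (subst (_≤ 1) (sym (∣⊥∣≡0 m)) z≤n , singletons j)))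

  private
    Gain : Subset (m + n) → Subset (m + n) → Set
    Gain A B = ∃ λ x → x ∈ˢ A × (B ∪ ⁅ x ⁆) ∈F extension

    gainˡ : ∀ {P P′ : Subset m} {Q Q′ : Subset n} {i} → i ∈ˢ P → Member (P′ ∪ ⁅ i ⁆ , Q′) → Gain (P ++ Q) (P′ ++ Q′)
    gainˡ {P} {P′} {Q} {Q′} {i} i∈P new = (i ↑ˡ n) , ∈-++ˡ i∈P ,
      subst (_∈F extension) (sym (∪⁅↑ˡ⁆ P′ Q′ i)) (member⁺ (P′ ∪ ⁅ i ⁆) Q′ new)

    gainʳ : ∀ {P P′ : Subset m} {Q Q′ : Subset n} {i} → i ∈ˢ Q → Member (P′ , Q′ ∪ ⁅ i ⁆) → Gain (P ++ Q) (P′ ++ Q′)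
    gainʳ {P} {P′} {Q} {Q′} {i} i∈Q new = (m ↑ʳ i) , ∈-++ʳ i∈Q ,
      subst (_∈F extension) (sym (∪⁅↑ʳ⁆ P′ Q′ i)) (member⁺ P′ (Q′ ∪ ⁅ i ⁆) new)

    nonempty-member : ∀ P {Q} → Nonempty Q → Member (P , Q) → ∣ P ∣ ≤ 1 × Q ∈F F
    nonempty-member P (x , x∈Q) (inj₁ refl) = ⊥-elim (∉⊥ x∈Q)
    nonempty-member P Q≠∅       (inj₂ PQ∈)  = PQ∈

    ∣⊥∪⁅i⁆∣≤1 : ∀ i → ∣ ⊥ {m} ∪ ⁅ i ⁆ ∣ ≤ 1
    ∣⊥∪⁅i⁆∣≤1 i = ℕₚ.≤-reflexive (trans (cong ∣_∣ (∪-identityˡ ⁅ i ⁆)) (∣⁅x⁆∣≡1 i))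

    -- The first set lies in the new block. If the second has a new point, the first can absorb it
    -- and stay inside the block. Otherwise the second has room for one new point and takes it from
    -- the first.
    mixed : ∀ (P P′ : Subset m) {Q Q′ : Subset n} → Nonempty P → Q ≡ ⊥ → ∣ P′ ∣ ≤ 1 → Q′ ∈F F →
            Gain (P ++ Q) (P′ ++ Q′) ⊎ Gain (P′ ++ Q′) (P ++ Q)
    mixed P P′ (i , i∈P) refl ∣P′∣≤1 Q′∈F with nonempty? P′
    ... | yes (j , j∈P′) = inj₂ (gainˡ j∈P′ (inj₁ refl))
    ... | no P′≡∅ rewrite Empty-unique P′≡∅ = inj₁ (gainˡ i∈P (inj₂ (∣⊥∪⁅i⁆∣≤1 i , Q′∈F)))

  extension-exchange : WeakExchange F → WeakExchange extension
  extension-exchange exchange A B A∈ B∈ A≠∅ B≠∅ A∩B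
    with P , Q , refl , PQ∈ ← member⁻ A∈ | P′ , Q′ , refl , P′Q′∈ ← member⁻ B∈
    with nonempty? Q | nonempty? Q′
  -- Both sets lie inside the new block, all of whose subsets are members, so any point can be
  -- passed over.
  ... | no Q≡∅ | no Q′≡∅ = inj₁ (gainˡ (proj₂ (¬Nonempty⇒Nonempty-++ P A≠∅ Q≡∅)) (inj₁ (Empty-unique Q′≡∅)))
  ... | no Q≡∅ | yes Q′≠∅ with ∣P′∣≤1 , Q′∈F ← nonempty-member P′ Q′≠∅ P′Q′∈ =
    mixed P P′ (¬Nonempty⇒Nonempty-++ P A≠∅ Q≡∅) (Empty-unique Q≡∅) ∣P′∣≤1 Q′∈F
  ... | yes Q≠∅ | no Q′≡∅ with ∣P∣≤1 , Q∈F ← nonempty-member P Q≠∅ PQ∈ =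
    swap (mixed P′ P (¬Nonempty⇒Nonempty-++ P′ B≠∅ Q′≡∅) (Empty-unique Q′≡∅) ∣P∣≤1 Q∈F)
  ... | yes Q≠∅ | yes Q′≠∅
    with ∣P∣≤1 , Q∈F ← nonempty-member P Q≠∅ PQ∈ | ∣P′∣≤1 , Q′∈F ← nonempty-member P′ Q′≠∅ P′Q′∈
    with exchange Q Q′ Q∈F Q′∈F Q≠∅ Q′≠∅ (proj₂ (Disjoint-++⁻ P P′ A∩B))
  -- Both sets have old points: the exchange happens between the old parts in `F`, and the new parts
  -- keep their size.
  ... | inj₁ (i , i∈Q , new)  = inj₁ (gainʳ i∈Q (inj₂ (∣P′∣≤1 , new)))
  ... | inj₂ (i , i∈Q′ , new) = inj₂ (gainʳ i∈Q′ (inj₂ (∣P∣≤1 , new)))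

  extension-size : ∀ {r} → m ≤ suc r → (∀ {A} → A ∈F F → ∣ A ∣ ≤ r) → ∀ {A} → A ∈F extension → ∣ A ∣ ≤ suc r
  extension-size {r} m≤1+r small A∈ with member⁻ A∈
  ... | P , Q , refl , inj₁ refl = begin
    ∣ P ++ ⊥ {n} ∣      ≡⟨ ∣++∣ P (⊥ {n}) ⟩
    ∣ P ∣ + ∣ ⊥ {n} ∣   ≡⟨ cong (∣ P ∣ +_) (∣⊥∣≡0 n) ⟩
    ∣ P ∣ + 0           ≡⟨ ℕₚ.+-identityʳ _ ⟩
    ∣ P ∣               ≤⟨ ∣p∣≤n P ⟩
    m                   ≤⟨ m≤1+r ⟩
    suc r               ∎
    where open ℕₚ.≤-Reasoning
  ... | P , Q , refl , inj₂ (∣P∣≤1 , Q∈F) = begin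
    ∣ P ++ Q ∣      ≡⟨ ∣++∣ P Q ⟩
    ∣ P ∣ + ∣ Q ∣   ≤⟨ ℕₚ.+-mono-≤ ∣P∣≤1 (small Q∈F) ⟩
    suc r           ∎
    where open ℕₚ.≤-Reasoning

splitOff : ∀ r n → n ≤ tri (suc r) → ∃₂ λ m k → n ≡ m + k × m ≤ suc r × k ≤ tri r
splitOff r n n≤tri with ℕₚ.≤-total n (suc r)
... | inj₁ n≤1+r = n , 0 , sym (ℕₚ.+-identityʳ n) , n≤1+r , z≤n
... | inj₂ 1+r≤n = suc r , n ℕ.∸ suc r , sym (ℕₚ.m+[n∸m]≡n 1+r≤n) , ℕₚ.≤-refl ,
  ℕₚ.≤-trans (ℕₚ.∸-monoˡ-≤ (suc r) n≤tri) (ℕₚ.≤-reflexive (ℕₚ.m+n∸m≡n (suc r) (tri r)))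

-- Blocks of sizes at most 1, 2, ..., r are added in turn to the system consisting of the empty set
-- on no points. Blocks may be short or empty, so `n` need not be triangular.
goodSystem : ∀ r n → n ≤ tri r → ∃ λ (F : System n) → Good F × (∀ {A} → A ∈F F → ∣ A ∣ ≤ r)
goodSystem zero zero _ =
  system ([] ∷ []) ([] ∷ []) , ((here refl , λ ()) , λ _ _ _ _ ()) , λ { (here refl) → z≤n }
goodSystem (suc r) n n≤tri
  with m , k , refl , m≤1+r , k≤tri ← splitOff r n n≤tri
  with F , (atomic , exchange) , small ← goodSystem r k k≤tri
  = extension , (extension-atomic atomic , extension-exchange exchange) , extension-size m≤1+r small
  where open Extension {m} F

-- Arithmetic

m²≤n²⇒m≤n : ∀ {m n} → m * m ≤ n * n → m ≤ n
m²≤n²⇒m≤n m²≤n² = ℕₚ.≮⇒≥ λ n<m → ℕₚ.<⇒≱ (ℕₚ.*-mono-< n<m n<m) m²≤n²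

-- Completing the square in 8 · c(c+1)/2 + 1. This links triangular numbers to the odd squares in
-- `IsRoundSqrt2n`.
1+8*tri : ∀ c → suc (8 * tri c) ≡ (2 * c + 1) * (2 * c + 1)
1+8*tri zero    = refl
1+8*tri (suc c) = begin
  suc (8 * (suc c + tri c))                    ≡⟨ expand c (tri c) ⟩
  8 * suc c + suc (8 * tri c)                  ≡⟨ cong (8 * suc c +_) (1+8*tri c) ⟩
  8 * suc c + (2 * c + 1) * (2 * c + 1)        ≡⟨ square c ⟩
  (2 * suc c + 1) * (2 * suc c + 1)            ∎
  where
  open ≡-Reasoning
  expand : ∀ c t → suc (8 * (suc c + t)) ≡ 8 * suc c + suc (8 * t)
  expand = solve-∀
  square : ∀ c → 8 * suc c + (2 * c + 1) * (2 * c + 1) ≡ (2 * suc c + 1) * (2 * suc c + 1)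
  square = solve-∀

bracket : ∀ n → ∃ λ c → 8 * tri c ≤ n × n ℕ.< 8 * tri (suc c)
bracket zero    = 0 , z≤n , s≤s z≤n
bracket (suc n) with bracket n
... | c , lower , upper with suc n ℕ.<? 8 * tri (suc c)
...   | yes below = c , ℕₚ.m≤n⇒m≤1+n lower , below
...   | no above  = suc c , ℕₚ.≮⇒≥ above ,
        -- Consecutive values of `8 * tri` differ by more than 1, so the index moves by at most one
        -- when `n` does.
        ℕₚ.≤-trans (s≤s upper) (ℕₚ.*-monoʳ-< 8 (ℕₚ.m<n+m (tri (suc c)) {suc (suc c)} (s≤s z≤n)))

-- `bracket` is applied to the predecessor of the given number, which makes the lower bound strict,
-- as `q^c≤card` with `q` = 8 requires.
largeRoot : ∀ n → 10000 ≤ n → ∃ λ c → 48 ≤ c × 8 * tri c ℕ.< n × n ≤ (2 * c + 3) * (2 * c + 3)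
largeRoot (suc n) 10000≤1+n with c , lower , upper ← bracket n = c , 48≤c , s≤s lower , 1+n≤
  where
  open ℕₚ.≤-Reasoning
  1+n≤ : suc n ≤ (2 * c + 3) * (2 * c + 3)
  1+n≤ = begin
    suc n                              ≤⟨ ℕₚ.m≤n⇒m≤1+n upper ⟩
    suc (8 * tri (suc c))              ≡⟨ 1+8*tri (suc c) ⟩
    (2 * suc c + 1) * (2 * suc c + 1)  ≡⟨ shift c ⟩
    (2 * c + 3) * (2 * c + 3)          ∎
    where
    shift : ∀ c → (2 * suc c + 1) * (2 * suc c + 1) ≡ (2 * c + 3) * (2 * c + 3)
    shift = solve-∀
  48≤c : 48 ≤ c
  -- From 100² ≤ (2c+3)² follows 97 ≤ 2c, hence 96 ≤ 2c. The threshold 10000 is chosen for this.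
  48≤c = ℕₚ.*-cancelˡ-≤ 2 (ℕₚ.≤-trans (ℕₚ.m≤m+n 96 1) (ℕₚ.+-cancelʳ-≤ 3 97 (2 * c)
           (m²≤n²⇒m≤n (ℕₚ.≤-trans 10000≤1+n 1+n≤))))

-- Naturals inside the rationals, and order on the rationals

⟦⟧ᵘ : ∀ a → ℚ.toℚᵘ ⟦ a ⟧ ℚᵘ.≃ ℚᵘ.mkℚᵘ (ℤ.+ a) 0
⟦⟧ᵘ a = ℚₚ.toℚᵘ-fromℚᵘ (ℚᵘ.mkℚᵘ (ℤ.+ a) 0)

-- `⟦_⟧` normalises by a gcd and does not compute on a variable, so the identity is checked on
-- unnormalised fractions with denominator 1.
⟦⟧-* : ∀ a b → ⟦ a * b ⟧ ≡ ⟦ a ⟧ ℚ.* ⟦ b ⟧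
⟦⟧-* a b = ℚₚ.toℚᵘ-injective (begin
  ℚ.toℚᵘ ⟦ a * b ⟧                                    ≈⟨ ⟦⟧ᵘ (a * b) ⟩
  ℚᵘ.mkℚᵘ (ℤ.+ (a * b)) 0                             ≡⟨ cong (λ z → ℚᵘ.mkℚᵘ z 0) (ℤₚ.pos-* a b) ⟩
  ℚᵘ.mkℚᵘ (ℤ.+ a) 0 ℚᵘ.* ℚᵘ.mkℚᵘ (ℤ.+ b) 0            ≈⟨ ℚᵘₚ.*-cong (⟦⟧ᵘ a) (⟦⟧ᵘ b) ⟨
  ℚ.toℚᵘ ⟦ a ⟧ ℚᵘ.* ℚ.toℚᵘ ⟦ b ⟧                      ≈⟨ ℚₚ.toℚᵘ-homo-* ⟦ a ⟧ ⟦ b ⟧ ⟨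
  ℚ.toℚᵘ (⟦ a ⟧ ℚ.* ⟦ b ⟧)                            ∎)
  where open ℚᵘₚ.≃-Reasoning

⟦⟧-+ : ∀ a b → ⟦ a + b ⟧ ≡ ⟦ a ⟧ ℚ.+ ⟦ b ⟧
⟦⟧-+ a b = ℚₚ.toℚᵘ-injective (begin
  ℚ.toℚᵘ ⟦ a + b ⟧                                    ≈⟨ ⟦⟧ᵘ (a + b) ⟩
  ℚᵘ.mkℚᵘ (ℤ.+ (a + b)) 0                             ≡⟨ cong₂ (λ y z → ℚᵘ.mkℚᵘ (y ℤ.+ z) 0) (ℤₚ.*-identityʳ (ℤ.+ a)) (ℤₚ.*-identityʳ (ℤ.+ b)) ⟨
  ℚᵘ.mkℚᵘ (ℤ.+ a) 0 ℚᵘ.+ ℚᵘ.mkℚᵘ (ℤ.+ b) 0            ≈⟨ ℚᵘₚ.+-cong (⟦⟧ᵘ a) (⟦⟧ᵘ b) ⟨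
  ℚ.toℚᵘ ⟦ a ⟧ ℚᵘ.+ ℚ.toℚᵘ ⟦ b ⟧                      ≈⟨ ℚₚ.toℚᵘ-homo-+ ⟦ a ⟧ ⟦ b ⟧ ⟨
  ℚ.toℚᵘ (⟦ a ⟧ ℚ.+ ⟦ b ⟧)                            ∎)
  where open ℚᵘₚ.≃-Reasoning

⟦⟧-mono-≤ : ∀ {a b} → a ≤ b → ⟦ a ⟧ ℚ.≤ ⟦ b ⟧
⟦⟧-mono-≤ {a} {b} a≤b = ℚₚ.toℚᵘ-cancel-≤ (begin
  ℚ.toℚᵘ ⟦ a ⟧            ≃⟨ ⟦⟧ᵘ a ⟩
  ℚᵘ.mkℚᵘ (ℤ.+ a) 0       ≤⟨ ℚᵘ.*≤* (ℤₚ.*-monoʳ-≤-nonNeg (ℤ.+ 1) (ℤ.+≤+ a≤b)) ⟩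
  ℚᵘ.mkℚᵘ (ℤ.+ b) 0       ≃⟨ ⟦⟧ᵘ b ⟨
  ℚ.toℚᵘ ⟦ b ⟧            ∎)
  where open ℚᵘₚ.≤-Reasoning

⟦⟧-cancel-≤ : ∀ {a b} → ⟦ a ⟧ ℚ.≤ ⟦ b ⟧ → a ≤ b
⟦⟧-cancel-≤ {a} {b} ⟦a⟧≤⟦b⟧ = ℤₚ.drop‿+≤+ (ℤₚ.*-cancelʳ-≤-pos (ℤ.+ a) (ℤ.+ b) (ℤ.+ 1) (ℚᵘₚ.drop-*≤* (begin
  ℚᵘ.mkℚᵘ (ℤ.+ a) 0       ≃⟨ ⟦⟧ᵘ a ⟨
  ℚ.toℚᵘ ⟦ a ⟧            ≤⟨ ℚₚ.toℚᵘ-mono-≤ ⟦a⟧≤⟦b⟧ ⟩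
  ℚ.toℚᵘ ⟦ b ⟧            ≃⟨ ⟦⟧ᵘ b ⟩
  ℚᵘ.mkℚᵘ (ℤ.+ b) 0       ∎)))
  where open ℚᵘₚ.≤-Reasoning

0≤⟦_⟧ : ∀ a → 0ℚ ℚ.≤ ⟦ a ⟧
0≤⟦ a ⟧ = ⟦⟧-mono-≤ {0} {a} z≤n

*-mono-≤ : ∀ {p q r s} → 0ℚ ℚ.≤ p → 0ℚ ℚ.≤ r → p ℚ.≤ q → r ℚ.≤ s → p ℚ.* r ℚ.≤ q ℚ.* s
*-mono-≤ {p} {q} {r} {s} 0≤p 0≤r p≤q r≤s = ℚₚ.≤-trans
  (ℚₚ.*-monoʳ-≤-nonNeg r {{ℚ.nonNegative 0≤r}} p≤q)
  (ℚₚ.*-monoˡ-≤-nonNeg q {{ℚ.nonNegative (ℚₚ.≤-trans 0≤p p≤q)}} r≤s)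

0≤p*q : ∀ {p q} → 0ℚ ℚ.≤ p → 0ℚ ℚ.≤ q → 0ℚ ℚ.≤ p ℚ.* q
0≤p*q {p} {q} 0≤p 0≤q = subst (ℚ._≤ p ℚ.* q) (ℚₚ.*-zeroˡ 0ℚ) (*-mono-≤ ℚₚ.≤-refl ℚₚ.≤-refl 0≤p 0≤q)

p²≤q²⇒p≤q : ∀ {p q} → 0ℚ ℚ.≤ q → p ℚ.* p ℚ.≤ q ℚ.* q → p ℚ.≤ q
p²≤q²⇒p≤q {p} {q} 0≤q p²≤q² = ℚₚ.≮⇒≥ λ q<p → ℚₚ.<-irrefl refl (begin-strict
  q ℚ.* q  ≤⟨ ℚₚ.*-monoˡ-≤-nonNeg q {{ℚ.nonNegative 0≤q}} (ℚₚ.<⇒≤ q<p) ⟩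
  q ℚ.* p  <⟨ ℚₚ.*-monoˡ-<-pos p {{ℚ.positive (ℚₚ.≤-<-trans 0≤q q<p)}} q<p ⟩
  p ℚ.* p  ≤⟨ p²≤q² ⟩
  q ℚ.* q  ∎)
  where open ℚₚ.≤-Reasoning

-- Partial sums of the exponential series

1/suc : ℕ → ℚ
1/suc k = ℤ.+ 1 ℚ./ suc k

0≤1/suc : ∀ k → 0ℚ ℚ.≤ 1/suc k
0≤1/suc k = ℚₚ.nonNegative⁻¹ (1/suc k) {{ℚₚ.normalize-nonNeg 1 (suc k)}}

⟦suc⟧*1/suc : ∀ k → ⟦ suc k ⟧ ℚ.* 1/suc k ≡ 1ℚ
⟦suc⟧*1/suc k = ℚₚ.toℚᵘ-injective (begin
  ℚ.toℚᵘ (⟦ suc k ⟧ ℚ.* 1/suc k)                          ≈⟨ ℚₚ.toℚᵘ-homo-* ⟦ suc k ⟧ (1/suc k) ⟩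
  ℚ.toℚᵘ ⟦ suc k ⟧ ℚᵘ.* ℚ.toℚᵘ (1/suc k)                  ≈⟨ ℚᵘₚ.*-cong (⟦⟧ᵘ (suc k)) (ℚₚ.toℚᵘ-fromℚᵘ (ℚᵘ.mkℚᵘ (ℤ.+ 1) k)) ⟩
  ℚᵘ.mkℚᵘ (ℤ.+ suc k) 0 ℚᵘ.* ℚᵘ.mkℚᵘ (ℤ.+ 1) k            ≈⟨ ℚᵘ.*≡* (cong ℤ.+_ (units (suc k))) ⟩
  ℚᵘ.1ℚᵘ                                                  ∎)
  where
  open ℚᵘₚ.≃-Reasoning
  units : ∀ a → a * 1 * 1 ≡ 1 * (1 * a)
  units = solve-∀

0≤expTerm : ∀ {x} → 0ℚ ℚ.≤ x → ∀ k → 0ℚ ℚ.≤ expTerm x k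
0≤expTerm 0≤x zero    = 0≤⟦ 1 ⟧
0≤expTerm 0≤x (suc k) = 0≤p*q (0≤p*q (0≤expTerm 0≤x k) 0≤x) (0≤1/suc k)

expTerm-mono : ∀ {x y} → 0ℚ ℚ.≤ x → x ℚ.≤ y → ∀ k → expTerm x k ℚ.≤ expTerm y k
expTerm-mono 0≤x x≤y zero    = ℚₚ.≤-refl
expTerm-mono 0≤x x≤y (suc k) = *-mono-≤ (0≤p*q (0≤expTerm 0≤x k) 0≤x) (0≤1/suc k)
  (*-mono-≤ (0≤expTerm 0≤x k) 0≤x (expTerm-mono 0≤x x≤y k) x≤y) ℚₚ.≤-refl

expPartial-mono : ∀ {x y} → 0ℚ ℚ.≤ x → x ℚ.≤ y → ∀ N → expPartial x N ℚ.≤ expPartial y N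
expPartial-mono 0≤x x≤y zero    = ℚₚ.≤-refl
expPartial-mono 0≤x x≤y (suc N) = ℚₚ.+-mono-≤ (expPartial-mono 0≤x x≤y N) (expTerm-mono 0≤x x≤y N)

-- The recursion of `expTerm` with its denominator cleared; it lets `expTerm-+` collect multiples of
-- one term.
expTerm-*x : ∀ x k → expTerm x k ℚ.* x ≡ ⟦ suc k ⟧ ℚ.* expTerm x (suc k)
expTerm-*x x k = begin
  e ℚ.* x                                ≡⟨ ℚₚ.*-identityˡ _ ⟨
  1ℚ ℚ.* (e ℚ.* x)                       ≡⟨ cong (ℚ._* (e ℚ.* x)) (⟦suc⟧*1/suc k) ⟨
  ⟦ suc k ⟧ ℚ.* 1/suc k ℚ.* (e ℚ.* x)    ≡⟨ solve 3 (λ a u y → a :* u :* y := a :* (y :* u)) refl ⟦ suc k ⟧ (1/suc k) (e ℚ.* x) ⟩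
  ⟦ suc k ⟧ ℚ.* (e ℚ.* x ℚ.* 1/suc k)    ∎
  where
  open ≡-Reasoning
  e = expTerm x k

-- Mean value inequality: the derivative of x^(k+1)/(k+1)! is x^k/k!, which is increasing.
expTerm-+ : ∀ {x h} → 0ℚ ℚ.≤ x → 0ℚ ℚ.≤ h → ∀ k →
            expTerm (x ℚ.+ h) (suc k) ℚ.≤ expTerm x (suc k) ℚ.+ h ℚ.* expTerm (x ℚ.+ h) k
expTerm-+ {x} {h} 0≤x 0≤h zero = ℚₚ.≤-reflexive
  (solve 2 (λ x h → con 1ℚ :* (x :+ h) :* con 1ℚ := con 1ℚ :* x :* con 1ℚ :+ h :* con 1ℚ) refl x h)
expTerm-+ {x} {h} 0≤x 0≤h (suc k) = begin
  e₁ ℚ.* (x ℚ.+ h) ℚ.* u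
    ≡⟨ solve 4 (λ e x h u → e :* (x :+ h) :* u := e :* (x :* u) :+ h :* (e :* u)) refl e₁ x h u ⟩
  e₁ ℚ.* (x ℚ.* u) ℚ.+ h ℚ.* (e₁ ℚ.* u)
    ≤⟨ ℚₚ.+-monoˡ-≤ (h ℚ.* (e₁ ℚ.* u))
         (ℚₚ.*-monoʳ-≤-nonNeg (x ℚ.* u) {{ℚ.nonNegative (0≤p*q 0≤x 0≤u)}} (expTerm-+ 0≤x 0≤h k)) ⟩
  (f ℚ.+ h ℚ.* e₀) ℚ.* (x ℚ.* u) ℚ.+ h ℚ.* (e₁ ℚ.* u)
    ≡⟨ solve 6 (λ f h e x u g → (f :+ h :* e) :* (x :* u) :+ h :* g := f :* x :* u :+ (e :* x :* (h :* u) :+ h :* g))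
         refl f h e₀ x u (e₁ ℚ.* u) ⟩
  f ℚ.* x ℚ.* u ℚ.+ (e₀ ℚ.* x ℚ.* (h ℚ.* u) ℚ.+ h ℚ.* (e₁ ℚ.* u))
    -- Enlarging `x` to `x + h` turns the first summand into k + 1 copies of h · `e₁` · `u`. With
    -- the remaining copy there are k + 2, and `u` is 1/(k+2).
    ≤⟨ ℚₚ.+-monoʳ-≤ (f ℚ.* x ℚ.* u) (ℚₚ.+-monoˡ-≤ (h ℚ.* (e₁ ℚ.* u))
         (ℚₚ.*-monoʳ-≤-nonNeg (h ℚ.* u) {{ℚ.nonNegative (0≤p*q 0≤h 0≤u)}}
           (ℚₚ.*-monoˡ-≤-nonNeg e₀ {{ℚ.nonNegative (0≤expTerm 0≤y k)}} x≤y))) ⟩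
  f ℚ.* x ℚ.* u ℚ.+ (e₀ ℚ.* (x ℚ.+ h) ℚ.* (h ℚ.* u) ℚ.+ h ℚ.* (e₁ ℚ.* u))
    ≡⟨ cong (λ z → f ℚ.* x ℚ.* u ℚ.+ (z ℚ.* (h ℚ.* u) ℚ.+ h ℚ.* (e₁ ℚ.* u))) (expTerm-*x (x ℚ.+ h) k) ⟩
  f ℚ.* x ℚ.* u ℚ.+ (⟦ suc k ⟧ ℚ.* e₁ ℚ.* (h ℚ.* u) ℚ.+ h ℚ.* (e₁ ℚ.* u))
    ≡⟨ cong (f ℚ.* x ℚ.* u ℚ.+_)
         (solve 4 (λ a e h u → a :* e :* (h :* u) :+ h :* (e :* u) := h :* (e :* ((con 1ℚ :+ a) :* u))) refl ⟦ suc k ⟧ e₁ h u) ⟩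
  f ℚ.* x ℚ.* u ℚ.+ h ℚ.* (e₁ ℚ.* ((1ℚ ℚ.+ ⟦ suc k ⟧) ℚ.* u))
    ≡⟨ cong (λ z → f ℚ.* x ℚ.* u ℚ.+ h ℚ.* (e₁ ℚ.* z))
         (trans (cong (ℚ._* u) (sym (⟦⟧-+ 1 (suc k)))) (⟦suc⟧*1/suc (suc k))) ⟩
  f ℚ.* x ℚ.* u ℚ.+ h ℚ.* (e₁ ℚ.* 1ℚ)
    ≡⟨ cong (λ z → f ℚ.* x ℚ.* u ℚ.+ h ℚ.* z) (ℚₚ.*-identityʳ e₁) ⟩
  f ℚ.* x ℚ.* u ℚ.+ h ℚ.* e₁ ∎
  where
  open ℚₚ.≤-Reasoning
  e₀ = expTerm (x ℚ.+ h) k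
  e₁ = expTerm (x ℚ.+ h) (suc k)
  f = expTerm x (suc k)
  u = 1/suc (suc k)
  0≤u = 0≤1/suc (suc k)
  x≤y : x ℚ.≤ x ℚ.+ h
  x≤y = subst (ℚ._≤ x ℚ.+ h) (ℚₚ.+-identityʳ x) (ℚₚ.+-monoʳ-≤ x 0≤h)
  0≤y = ℚₚ.≤-trans 0≤x x≤y

-- `expTerm-+` summed over the terms. The constant term has derivative zero, so the factor of `h`
-- has one term fewer.
expPartial-+ : ∀ {x h} → 0ℚ ℚ.≤ x → 0ℚ ℚ.≤ h → ∀ N →
               expPartial (x ℚ.+ h) (suc N) ℚ.≤ expPartial x (suc N) ℚ.+ h ℚ.* expPartial (x ℚ.+ h) N
expPartial-+ {x} {h} 0≤x 0≤h zero = ℚₚ.≤-reflexive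
  (solve 1 (λ h → con 1ℚ := con 1ℚ :+ h :* con 0ℚ) refl h)
expPartial-+ {x} {h} 0≤x 0≤h (suc N) = begin
  expPartial (x ℚ.+ h) (suc N) ℚ.+ expTerm (x ℚ.+ h) (suc N)
    ≤⟨ ℚₚ.+-mono-≤ (expPartial-+ 0≤x 0≤h N) (expTerm-+ 0≤x 0≤h N) ⟩
  expPartial x (suc N) ℚ.+ h ℚ.* expPartial (x ℚ.+ h) N ℚ.+ (expTerm x (suc N) ℚ.+ h ℚ.* expTerm (x ℚ.+ h) N)
    ≡⟨ solve 5 (λ a b c d h → a :+ h :* b :+ (c :+ h :* d) := a :+ c :+ h :* (b :+ d)) refl
         (expPartial x (suc N)) (expPartial (x ℚ.+ h) N) (expTerm x (suc N)) (expTerm (x ℚ.+ h) N) h ⟩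
  expPartial x (suc (suc N)) ℚ.+ h ℚ.* expPartial (x ℚ.+ h) (suc N) ∎
  where
  open ℚₚ.≤-Reasoning

expPartial-suc : ∀ {x} → 0ℚ ℚ.≤ x → ∀ N → expPartial x N ℚ.≤ expPartial x (suc N)
expPartial-suc {x} 0≤x N = subst (ℚ._≤ expPartial x (suc N)) (ℚₚ.+-identityʳ _)
  (ℚₚ.+-monoʳ-≤ (expPartial x N) (0≤expTerm 0≤x N))

expPartial-0 : ∀ N → expPartial 0ℚ (suc N) ≡ 1ℚ
expPartial-0 zero    = refl
expPartial-0 (suc N) = cong₂ ℚ._+_ (expPartial-0 N)
  (trans (cong (ℚ._* 1/suc N) (ℚₚ.*-zeroʳ (expTerm 0ℚ N))) (ℚₚ.*-zeroˡ (1/suc N)))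

1/64 : ℚ
1/64 = ℤ.+ 1 ℚ./ 64

-- With h = 1/64, `expPartial-+` gives E(x+h) ≤ E(x) + h E(x+h), that is, (1 - h) E(x+h) ≤ E(x).
expPartial-step : ∀ {x} → 0ℚ ℚ.≤ x → ∀ N →
                  ⟦ 63 ⟧ ℚ.* expPartial (x ℚ.+ 1/64) (suc N) ℚ.≤ ⟦ 64 ⟧ ℚ.* expPartial x (suc N)
expPartial-step {x} 0≤x N = begin
  ⟦ 63 ⟧ ℚ.* E              ≡⟨ solve 1 (λ e → con ⟦ 63 ⟧ :* e := con ⟦ 64 ⟧ :* e :+ (:- e)) refl E ⟩
  ⟦ 64 ⟧ ℚ.* E ℚ.- E        ≤⟨ ℚₚ.+-monoˡ-≤ (ℚ.- E) (ℚₚ.*-monoˡ-≤-nonNeg ⟦ 64 ⟧ E≤) ⟩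
  ⟦ 64 ⟧ ℚ.* (expPartial x (suc N) ℚ.+ 1/64 ℚ.* E) ℚ.- E
    ≡⟨ solve 2 (λ a e → con ⟦ 64 ⟧ :* (a :+ con 1/64 :* e) :+ (:- e) := con ⟦ 64 ⟧ :* a) refl (expPartial x (suc N)) E ⟩
  ⟦ 64 ⟧ ℚ.* expPartial x (suc N) ∎
  where
  open ℚₚ.≤-Reasoning
  E = expPartial (x ℚ.+ 1/64) (suc N)
  0≤1/64 : 0ℚ ℚ.≤ 1/64
  0≤1/64 = ℚₚ.≤ᵇ⇒≤ tt
  E≤ : E ℚ.≤ expPartial x (suc N) ℚ.+ 1/64 ℚ.* E
  E≤ = ℚₚ.≤-trans (expPartial-+ 0≤x 0≤1/64 N)
    (ℚₚ.+-monoʳ-≤ (expPartial x (suc N)) (ℚₚ.*-monoˡ-≤-nonNeg 1/64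
      (expPartial-suc (ℚₚ.+-mono-≤ 0≤x 0≤1/64) N)))

-- Iterating the step from 0 gives e^(M/64) ≤ (64/63)^M, written without fractions.
expPartial-grid : ∀ M N → ⟦ 63 ^ M ⟧ ℚ.* expPartial (⟦ M ⟧ ℚ.* 1/64) (suc N) ℚ.≤ ⟦ 64 ^ M ⟧
expPartial-grid zero    N = ℚₚ.≤-reflexive (trans (ℚₚ.*-identityˡ _) (expPartial-0 N))
expPartial-grid (suc M) N = begin
  ⟦ 63 * 63 ^ M ⟧ ℚ.* expPartial (⟦ suc M ⟧ ℚ.* 1/64) (suc N)
    ≡⟨ cong₂ (λ a x → a ℚ.* expPartial x (suc N)) (⟦⟧-* 63 (63 ^ M)) shift ⟩
  ⟦ 63 ⟧ ℚ.* ⟦ 63 ^ M ⟧ ℚ.* expPartial (x ℚ.+ 1/64) (suc N)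
    ≡⟨ solve 3 (λ a b e → a :* b :* e := b :* (a :* e)) refl ⟦ 63 ⟧ ⟦ 63 ^ M ⟧ (expPartial (x ℚ.+ 1/64) (suc N)) ⟩
  ⟦ 63 ^ M ⟧ ℚ.* (⟦ 63 ⟧ ℚ.* expPartial (x ℚ.+ 1/64) (suc N))
    ≤⟨ ℚₚ.*-monoˡ-≤-nonNeg ⟦ 63 ^ M ⟧ {{ℚ.nonNegative 0≤⟦ 63 ^ M ⟧}}
         (expPartial-step (0≤p*q 0≤⟦ M ⟧ (ℚₚ.≤ᵇ⇒≤ tt)) N) ⟩
  ⟦ 63 ^ M ⟧ ℚ.* (⟦ 64 ⟧ ℚ.* expPartial x (suc N))
    ≡⟨ solve 3 (λ a b e → b :* (a :* e) := a :* (b :* e)) refl ⟦ 64 ⟧ ⟦ 63 ^ M ⟧ (expPartial x (suc N)) ⟩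
  ⟦ 64 ⟧ ℚ.* (⟦ 63 ^ M ⟧ ℚ.* expPartial x (suc N))
    ≤⟨ ℚₚ.*-monoˡ-≤-nonNeg ⟦ 64 ⟧ (expPartial-grid M N) ⟩
  ⟦ 64 ⟧ ℚ.* ⟦ 64 ^ M ⟧
    ≡⟨ ⟦⟧-* 64 (64 ^ M) ⟨
  ⟦ 64 * 64 ^ M ⟧ ∎
  where
  open ℚₚ.≤-Reasoning
  x = ⟦ M ⟧ ℚ.* 1/64
  shift : ⟦ suc M ⟧ ℚ.* 1/64 ≡ x ℚ.+ 1/64
  shift = trans (cong (ℚ._* 1/64) (⟦⟧-+ 1 M))
    (solve 2 (λ m h → (con 1ℚ :+ m) :* h := m :* h :+ h) refl ⟦ M ⟧ 1/64)

[m*n]^k : ∀ m n k → (m * n) ^ k ≡ m ^ k * n ^ k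
[m*n]^k m n zero    = refl
[m*n]^k m n (suc k) = trans (cong (m * n *_) ([m*n]^k m n k)) (interchange m n (m ^ k) (n ^ k))
  where
  interchange : ∀ a b c d → a * b * (c * d) ≡ a * c * (b * d)
  interchange = solve-∀

-- e^(132/64) ≤ (64/63)^132 ≤ 8.
exp≤8^ : ∀ {x} c → 0ℚ ℚ.≤ x → ⟦ 64 ⟧ ℚ.* x ℚ.≤ ⟦ 132 * c ⟧ → ∀ N → expPartial x N ℚ.≤ ⟦ 8 ^ c ⟧
exp≤8^ {x} c 0≤x 64x≤ N = ℚₚ.*-cancelˡ-≤-pos ⟦ 63 ^ M ⟧ {{ℚₚ.normalize-pos (63 ^ M) 1 {{_}} {{ℕₚ.m^n≢0 63 M}}}} (begin
  ⟦ 63 ^ M ⟧ ℚ.* expPartial x N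
    ≤⟨ ℚₚ.*-monoˡ-≤-nonNeg ⟦ 63 ^ M ⟧ {{ℚ.nonNegative 0≤⟦ 63 ^ M ⟧}}
         (ℚₚ.≤-trans (expPartial-suc 0≤x N) (expPartial-mono 0≤x x≤ (suc N))) ⟩
  ⟦ 63 ^ M ⟧ ℚ.* expPartial (⟦ M ⟧ ℚ.* 1/64) (suc N)
    ≤⟨ expPartial-grid M N ⟩
  ⟦ 64 ^ M ⟧
    ≤⟨ ⟦⟧-mono-≤ powers ⟩
  ⟦ 63 ^ M * 8 ^ c ⟧
    ≡⟨ ⟦⟧-* (63 ^ M) (8 ^ c) ⟩
  ⟦ 63 ^ M ⟧ ℚ.* ⟦ 8 ^ c ⟧ ∎)
  where
  open ℚₚ.≤-Reasoning
  M = 132 * c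
  x≤ : x ℚ.≤ ⟦ M ⟧ ℚ.* 1/64
  x≤ = subst (ℚ._≤ ⟦ M ⟧ ℚ.* 1/64)
    (solve 1 (λ x → con ⟦ 64 ⟧ :* x :* con 1/64 := x) refl x)
    (ℚₚ.*-monoʳ-≤-nonNeg 1/64 64x≤)
  module ℕR = ℕₚ.≤-Reasoning
  powers : 64 ^ M ≤ 63 ^ M * 8 ^ c
  powers = ℕR.begin
    64 ^ M                     ℕR.≡⟨ ℕₚ.^-*-assoc 64 132 c ⟨
    -- Checked by evaluation; 132 is the largest exponent k with (64/63)^k ≤ 8.
    (64 ^ 132) ^ c             ℕR.≤⟨ ℕₚ.^-monoˡ-≤ c (ℕₚ.≤ᵇ⇒≤ (64 ^ 132) (63 ^ 132 * 8) tt) ⟩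
    (63 ^ 132 * 8) ^ c         ℕR.≡⟨ [m*n]^k (63 ^ 132) 8 c ⟩
    (63 ^ 132) ^ c * 8 ^ c     ℕR.≡⟨ cong (_* 8 ^ c) (ℕₚ.^-*-assoc 63 132 c) ⟩
    63 ^ M * 8 ^ c             ℕR.∎

-- 7/10 < 1/√2, and already 1 + x + x²/2 + x³/6 exceeds 2 at x = 7/10.
belowConst⇒≤1 : ∀ {α} → BelowConst α → α ℚ.≤ 1ℚ
belowConst⇒≤1 {α} (s , 0<s , 1<2s² , δ , 0<δ , bound) = ℚₚ.≮⇒≥ λ 1<α →
  ℚₚ.<-irrefl refl (begin-strict
    ⟦ 2 ⟧                                 ≡⟨ ℚₚ.*-identityˡ ⟦ 2 ⟧ ⟨
    1ℚ ℚ.* ⟦ 2 ⟧                          <⟨ ℚₚ.*-monoˡ-<-pos ⟦ 2 ⟧ 1<α ⟩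
    α ℚ.* ⟦ 2 ⟧                           ≤⟨ ℚₚ.*-monoˡ-≤-nonNeg α {{ℚ.nonNegative (ℚₚ.<⇒≤ (ℚₚ.<-trans (ℚₚ.positive⁻¹ 1ℚ) 1<α))}} 2≤ ⟩
    α ℚ.* (expPartial s 4 ℚ.+ δ)          ≤⟨ bound 4 ⟩
    ⟦ 2 ⟧                                 ∎)
  where
  open ℚₚ.≤-Reasoning
  7/10 = ℤ.+ 7 ℚ./ 10
  7/10≤s : 7/10 ℚ.≤ s
  7/10≤s = ℚₚ.≮⇒≥ λ s<7/10 → ℚₚ.<-irrefl refl (begin-strict
    1ℚ                       <⟨ 1<2s² ⟩
    ⟦ 2 ⟧ ℚ.* s ℚ.* s        ≤⟨ *-mono-≤ {⟦ 2 ⟧ ℚ.* s} {⟦ 2 ⟧ ℚ.* 7/10} {s} {7/10} (0≤p*q 0≤⟦ 2 ⟧ 0≤s) 0≤s (ℚₚ.*-monoˡ-≤-nonNeg ⟦ 2 ⟧ (ℚₚ.<⇒≤ s<7/10)) (ℚₚ.<⇒≤ s<7/10) ⟩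
    ⟦ 2 ⟧ ℚ.* 7/10 ℚ.* 7/10  ≤⟨ ℚₚ.≤ᵇ⇒≤ tt ⟩
    1ℚ                       ∎)
    where 0≤s = ℚₚ.<⇒≤ 0<s
  2≤ : ⟦ 2 ⟧ ℚ.≤ expPartial s 4 ℚ.+ δ
  2≤ = begin
    ⟦ 2 ⟧                    ≤⟨ ℚₚ.≤ᵇ⇒≤ tt ⟩
    expPartial 7/10 4        ≤⟨ expPartial-mono (ℚₚ.≤ᵇ⇒≤ tt) 7/10≤s 4 ⟩
    expPartial s 4           ≡⟨ ℚₚ.+-identityʳ _ ⟨
    expPartial s 4 ℚ.+ 0ℚ    ≤⟨ ℚₚ.+-monoʳ-≤ (expPartial s 4) (ℚₚ.<⇒≤ 0<δ) ⟩
    expPartial s 4 ℚ.+ δ     ∎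

-- Asymptotics

-- Here |F| ≥ 8^c = 2^(3c) while √n ≤ 2c + 3, so the exponent is about (3/2)√n. The gap between 1.42
-- = 71/50 and 3/2 absorbs the additive 3.
card≥2^[β√n] : ∀ {β} → 0ℚ ℚ.< β → β ℚ.< c142 → ∀ n → 10000 ≤ n → (F : System n) → Good F → GePow2Sqrt (card F) β n
card≥2^[β√n] {β} 0<β β<c142 n 10000≤n F good p t hyp with c , 48≤c , 8tri<n , n≤ ← largeRoot n 10000≤n = begin
  2 ^ p                ≤⟨ ℕₚ.^-monoʳ-≤ 2 p≤3cT ⟩
  2 ^ (3 * (c * T))    ≡⟨ ℕₚ.^-*-assoc 2 3 (c * T) ⟨
  8 ^ (c * T)          ≡⟨ ℕₚ.^-*-assoc 8 c T ⟨
  (8 ^ c) ^ T          ≤⟨ ℕₚ.^-monoˡ-≤ T (q^c≤card F good 8 c 8tri<n) ⟩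
  card F ^ T           ∎
  where
  open ℕₚ.≤-Reasoning
  T = suc t
  squares : 50 * p * (50 * p) ≤ 71 * 71 * n * T * T
  squares = ⟦⟧-cancel-≤ (ℚR.begin
    ⟦ 50 * p * (50 * p) ⟧
      ℚR.≡⟨ trans (⟦⟧-* (50 * p) (50 * p)) (cong₂ ℚ._*_ (⟦⟧-* 50 p) (⟦⟧-* 50 p)) ⟩
    ⟦ 50 ⟧ ℚ.* ⟦ p ⟧ ℚ.* (⟦ 50 ⟧ ℚ.* ⟦ p ⟧)
      ℚR.≡⟨ solve 2 (λ a x → a :* x :* (a :* x) := a :* a :* (x :* x)) refl ⟦ 50 ⟧ ⟦ p ⟧ ⟩
    ⟦ 50 ⟧ ℚ.* ⟦ 50 ⟧ ℚ.* (⟦ p ⟧ ℚ.* ⟦ p ⟧)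
      ℚR.≤⟨ ℚₚ.*-monoˡ-≤-nonNeg (⟦ 50 ⟧ ℚ.* ⟦ 50 ⟧) (ℚₚ.≤-trans hyp β≤c142) ⟩
    ⟦ 50 ⟧ ℚ.* ⟦ 50 ⟧ ℚ.* (c142 ℚ.* c142 ℚ.* ⟦ n ⟧ ℚ.* ⟦ T ⟧ ℚ.* ⟦ T ⟧)
      ℚR.≡⟨ solve 4 (λ a b x y → a :* a :* (b :* b :* x :* y :* y) := a :* b :* (a :* b) :* x :* y :* y)
              refl ⟦ 50 ⟧ c142 ⟦ n ⟧ ⟦ T ⟧ ⟩
    ⟦ 71 * 71 ⟧ ℚ.* ⟦ n ⟧ ℚ.* ⟦ T ⟧ ℚ.* ⟦ T ⟧
      ℚR.≡⟨ trans (⟦⟧-* (71 * 71 * n * T) T) (cong (ℚ._* ⟦ T ⟧)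
             (trans (⟦⟧-* (71 * 71 * n) T) (cong (ℚ._* ⟦ T ⟧) (⟦⟧-* (71 * 71) n)))) ⟨
    ⟦ 71 * 71 * n * T * T ⟧ ℚR.∎)
    where
    module ℚR = ℚₚ.≤-Reasoning
    0≤β = ℚₚ.<⇒≤ 0<β
    0≤⟦T⟧ = 0≤⟦ T ⟧
    β≤c142 : β ℚ.* β ℚ.* ⟦ n ⟧ ℚ.* ⟦ T ⟧ ℚ.* ⟦ T ⟧ ℚ.≤ c142 ℚ.* c142 ℚ.* ⟦ n ⟧ ℚ.* ⟦ T ⟧ ℚ.* ⟦ T ⟧
    β≤c142 =
      ℚₚ.*-monoʳ-≤-nonNeg ⟦ T ⟧ {{ℚ.nonNegative 0≤⟦T⟧}}
        (ℚₚ.*-monoʳ-≤-nonNeg ⟦ T ⟧ {{ℚ.nonNegative 0≤⟦T⟧}}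
          (ℚₚ.*-monoʳ-≤-nonNeg ⟦ n ⟧ {{ℚ.nonNegative 0≤⟦ n ⟧}}
            (*-mono-≤ 0≤β 0≤β (ℚₚ.<⇒≤ β<c142) (ℚₚ.<⇒≤ β<c142))))
  p≤3cT : p ≤ 3 * (c * T)
  p≤3cT = ℕₚ.*-cancelˡ-≤ 50 (begin
    50 * p                       ≤⟨ m²≤n²⇒m≤n (begin
      50 * p * (50 * p)                                    ≤⟨ squares ⟩
      71 * 71 * n * T * T                                  ≤⟨ ℕₚ.*-monoˡ-≤ T (ℕₚ.*-monoˡ-≤ T (ℕₚ.*-monoʳ-≤ (71 * 71) n≤)) ⟩
      71 * 71 * ((2 * c + 3) * (2 * c + 3)) * T * T        ≡⟨ regroup 71 (2 * c + 3) T ⟩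
      71 * (2 * c + 3) * T * (71 * (2 * c + 3) * T)        ∎) ⟩
    71 * (2 * c + 3) * T         ≤⟨ ℕₚ.*-monoˡ-≤ T linear ⟩
    50 * (3 * c) * T             ≡⟨ regroup′ 50 3 c T ⟩
    50 * (3 * (c * T))           ∎)
    where
    regroup : ∀ a d T → a * a * (d * d) * T * T ≡ a * d * T * (a * d * T)
    regroup = solve-∀
    regroup′ : ∀ a b c T → a * (b * c) * T ≡ a * (b * (c * T))
    regroup′ = solve-∀
    linear : 71 * (2 * c + 3) ≤ 50 * (3 * c)
    linear = begin
      71 * (2 * c + 3)      ≡⟨ ℕₚ.*-distribˡ-+ 71 (2 * c) 3 ⟩
      71 * (2 * c) + 213    ≡⟨ cong (_+ 213) (ℕₚ.*-assoc 71 2 c) ⟨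
      -- The constant 213 = 71 · 3 is covered by 8c, as c ≥ 48.
      142 * c + 213         ≤⟨ ℕₚ.+-monoʳ-≤ (142 * c) (ℕₚ.≤-trans (ℕₚ.m≤m+n 213 171) (ℕₚ.*-monoʳ-≤ 8 48≤c)) ⟩
      142 * c + 8 * c       ≡⟨ ℕₚ.*-distribʳ-+ c 142 8 ⟨
      150 * c               ≡⟨ ℕₚ.*-assoc 50 3 c ⟩
      50 * (3 * c)          ∎

-- Since `α` is at most 1, it is enough that e^√n ≤ 8^c. With √n ≤ 2c + 3 and e^(132/64) ≤ 8 this
-- reduces to the inequality `linear`.
card≥e^[α√n] : ∀ {α} → 0ℚ ℚ.< α → BelowConst α → ∀ n → 10000 ≤ n → (F : System n) → Good F → GeExpSqrt (card F) α n
card≥e^[α√n] {α} 0<α below n 10000≤n F good r 0≤r r²≤ N with c , 48≤c , 8tri<n , n≤ ← largeRoot n 10000≤n = begin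
  expPartial r N    ≤⟨ exp≤8^ c 0≤r (p²≤q²⇒p≤q 0≤⟦ 132 * c ⟧ squares) N ⟩
  ⟦ 8 ^ c ⟧         ≤⟨ ⟦⟧-mono-≤ (q^c≤card F good 8 c 8tri<n) ⟩
  ⟦ card F ⟧        ∎
  where
  open ℚₚ.≤-Reasoning
  0≤α = ℚₚ.<⇒≤ 0<α
  α≤1 = belowConst⇒≤1 below
  linear : 64 * (2 * c + 3) ≤ 132 * c
  linear = ℕR.begin
    64 * (2 * c + 3)        ℕR.≡⟨ ℕₚ.*-distribˡ-+ 64 (2 * c) 3 ⟩
    64 * (2 * c) + 192      ℕR.≡⟨ cong (_+ 192) (ℕₚ.*-assoc 64 2 c) ⟨
    -- The excess of 132 over 2 · 64 pays for 64 · 3 = 4 · 48 exactly when c ≥ 48.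
    128 * c + 4 * 48        ℕR.≤⟨ ℕₚ.+-monoʳ-≤ (128 * c) (ℕₚ.*-monoʳ-≤ 4 48≤c) ⟩
    128 * c + 4 * c         ℕR.≡⟨ ℕₚ.*-distribʳ-+ c 128 4 ⟨
    132 * c                 ℕR.∎
    where module ℕR = ℕₚ.≤-Reasoning
  regroup : ∀ a d → a * a * (d * d) ≡ a * d * (a * d)
  regroup = solve-∀
  squares : ⟦ 64 ⟧ ℚ.* r ℚ.* (⟦ 64 ⟧ ℚ.* r) ℚ.≤ ⟦ 132 * c ⟧ ℚ.* ⟦ 132 * c ⟧
  squares = begin
    ⟦ 64 ⟧ ℚ.* r ℚ.* (⟦ 64 ⟧ ℚ.* r)
      ≡⟨ solve 2 (λ a x → a :* x :* (a :* x) := a :* a :* (x :* x)) refl ⟦ 64 ⟧ r ⟩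
    ⟦ 64 * 64 ⟧ ℚ.* (r ℚ.* r)
      ≤⟨ ℚₚ.*-monoˡ-≤-nonNeg ⟦ 64 * 64 ⟧ r²≤ ⟩
    ⟦ 64 * 64 ⟧ ℚ.* (α ℚ.* α ℚ.* ⟦ n ⟧)
      ≤⟨ ℚₚ.*-monoˡ-≤-nonNeg ⟦ 64 * 64 ⟧ (*-mono-≤ (0≤p*q 0≤α 0≤α) 0≤⟦ n ⟧ (*-mono-≤ 0≤α 0≤α α≤1 α≤1) (⟦⟧-mono-≤ n≤)) ⟩
    ⟦ 64 * 64 ⟧ ℚ.* (1ℚ ℚ.* ⟦ (2 * c + 3) * (2 * c + 3) ⟧)
      ≡⟨ trans (cong (⟦ 64 * 64 ⟧ ℚ.*_) (ℚₚ.*-identityˡ ⟦ (2 * c + 3) * (2 * c + 3) ⟧)) (sym (⟦⟧-* (64 * 64) ((2 * c + 3) * (2 * c + 3)))) ⟩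
    ⟦ 64 * 64 * ((2 * c + 3) * (2 * c + 3)) ⟧
      ≡⟨ cong ⟦_⟧ (regroup 64 (2 * c + 3)) ⟩
    ⟦ 64 * (2 * c + 3) * (64 * (2 * c + 3)) ⟧
      ≤⟨ ⟦⟧-mono-≤ (ℕₚ.*-mono-≤ linear linear) ⟩
    ⟦ 132 * c * (132 * c) ⟧
      ≡⟨ ⟦⟧-* (132 * c) (132 * c) ⟩
    ⟦ 132 * c ⟧ ℚ.* ⟦ 132 * c ⟧ ∎

-- Strong exchange, the rank bound and its sharpness

strongExchange⇒weakExchange : ∀ {n} (F : System n) → StrongExchange F → WeakExchange F
strongExchange⇒weakExchange F exchange A B A∈F B∈F A≠∅ B≠∅ A∩B
  with exchange A B A∈F B∈F A≠∅ B≠∅ A∩B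
... | a , b , a∈A , b∈B , inj₁ (B+a∈F , _) = inj₁ (a , a∈A , B+a∈F)
... | a , b , a∈A , b∈B , inj₂ (A+b∈F , _) = inj₂ (b , b∈B , A+b∈F)

n≤tri[rk] : ∀ {n} (F : System n) → Good F → n ≤ tri (rk F)
n≤tri[rk] {n} F good = subst (_≤ tri (rk F)) (∣⊤∣≡n n) (∣X∣≤tri F good (rk F) ⊤ λ A∈F _ → ∣A∣≤rk F A∈F)

-- If the rank were at most k = r - 1, then 8n ≤ 8 `tri k` < (2k+1)² = (2r-1)², against the lower
-- half of the rounding condition.
isRound⇒≤rk : ∀ {n r} → IsRoundSqrt2n n r → (F : System n) → Good F → r ≤ rk F
isRound⇒≤rk {r = zero}      _                     F good = z≤n
isRound⇒≤rk {n} {r = suc k} (inj₂ lower , _) F good = ℕₚ.≮⇒≥ λ rk<1+k → ℕₚ.<⇒≱ lower (begin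
  8 * n                              ≤⟨ ℕₚ.*-monoʳ-≤ 8 (n≤tri[rk] F good) ⟩
  8 * tri (rk F)                     ≤⟨ ℕₚ.*-monoʳ-≤ 8 (tri-mono (ℕₚ.≤-pred rk<1+k)) ⟩
  8 * tri k                          ≤⟨ ℕₚ.n≤1+n _ ⟩
  suc (8 * tri k)                    ≡⟨ 1+8*tri k ⟩
  (2 * k + 1) * (2 * k + 1)          ≡⟨ cong (λ x → x * x) (odd k) ⟩
  (2 * suc k ℕ.∸ 1) * (2 * suc k ℕ.∸ 1) ∎)
  where
  open ℕₚ.≤-Reasoning
  -- The right side is what `2 * suc k ∸ 1` computes to.
  odd : ∀ k → 2 * k + 1 ≡ k + suc (k + 0)
  odd = solve-∀

-- The upper half of the rounding condition says 8n < (2r+1)² = 8 `tri r` + 1.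
isRound⇒≤tri : ∀ {n r} → IsRoundSqrt2n n r → n ≤ tri r
isRound⇒≤tri {n} {r} (_ , upper) =
  ℕₚ.*-cancelˡ-≤ 8 (ℕₚ.≤-pred (subst (suc (8 * n) ≤_) (sym (1+8*tri r)) upper))

-- The construction only bounds the rank above by `r`; equality comes from the lower bound valid for
-- every good system.
optimalSystem : ∀ n r → IsRoundSqrt2n n r → Σ (System n) λ F → Good F × rk F ≡ r
optimalSystem n r round with F , good , small ← goodSystem r n (isRound⇒≤tri {n} {r} round) =
  F , good , ℕₚ.≤-antisym (rk≤ F small) (isRound⇒≤rk {n} {r} round F good)

theorem1 : ((α : ℚ) → 0ℚ < α → BelowConst α →
    ∃ λ N₀ → ∀ n → N₀ ≤ n → (F : System n) → Good F → GeExpSqrt (card F) α n)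
    × ((β : ℚ) → 0ℚ < β → β < c142 →
    ∃ λ N₀ → ∀ n → N₀ ≤ n → (F : System n) → Good F → GePow2Sqrt (card F) β n)
    × (∀ n r → IsRoundSqrt2n n r → (F : System n) → Good F → r ≤ rk F)
    × (∀ n r → IsRoundSqrt2n n r → Σ (System n) λ F → Good F × rk F ≡ r)
    × ((β : ℚ) → 0ℚ < β → β < c142 →
    ∃ λ N₀ → ∀ n → N₀ ≤ n → (F : System n) → StrongGood F → GePow2Sqrt (card F) β n)
theorem1 =
    (λ α 0<α below → 10000 , card≥e^[α√n] 0<α below)
  , (λ β 0<β β<c142 → 10000 , card≥2^[β√n] 0<β β<c142)
  , (λ n r → isRound⇒≤rk {n} {r})
  , optimalSystem
  , (λ β 0<β β<c142 → 10000 , λ n 10000≤n F (atomic , _ , exchange) →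
      card≥2^[β√n] 0<β β<c142 n 10000≤n F (atomic , strongExchange⇒weakExchange F exchange))
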